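{- Let $A$ be a closed $\mathsf{\Lambda2}$-type. If $\kappa(A)=0$, then $A\equiv_{\mathsf Y}0+1+\dots+1$ (a finite sum of copies of $1$).
   Context: **Types.** Types are given by $A,B::=X\mid A\Rightarrow B\mid\forall X.A\mid 0\mid 1\mid A+B\mid A\times B\mid \mu X.A\mid\nu X.A$, where $\mu X.A,\nu X.A$ are allowed only when all occurrences of $X$ in $A$ are positive; types are taken up to renaming of bound variables. A $\mathsf{\Lambda2}$-type uses only variables, $\Rightarrow,\forall$. An occurrence of a variable is positive if it lies to the left of an even number of arrows, negative otherwise. $\langle C_i\rangle_i\Rightarrow B$ denotes $C_1\Rightarrow\dots\Rightarrow C_k\Rightarrow B$ ($B$ if the list is empty). Empty sums and products are $0$ and $1$. $\exists\vec Y.A$ is shorthand for $\forall Y'.(\forall\vec Y.(A\Rightarrow Y'))\Rightarrow Y'$ with $Y'$ fresh ($A$ if $\vec Y$ is empty). Substitutions are capture-avoiding. **The relation $\equiv_{\mathsf Y}$.** Smallest congruence on types (equivalence relation compatible with all type constructors) containing: (Y+) $\forall X.\forall\vec Y.\big\langle\forall\vec Z_k.\langle A_{jk}\rangle_{j\in J_k}\Rightarrow X\big\rangle_{k\in K}\Rightarrow B\ \equiv\ \forall\vec Y.B\big[\{\mu X.\}\sum_{k}\exists\vec Z_k.\prod_{j}A_{jk}/X\big]$, if $X$ has only positive occurrences in each $A_{jk}$ and in $B$; (Y−) $\forall X.\forall\vec Y.\big\langle\forall\vec Z_k.X\Rightarrow A_k\big\rangle_{k\in K}\Rightarrow B\ \equiv\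 \forall\vec Y.B\big[\{\nu X.\}\prod_k\forall\vec Z_k.A_k/X\big]$, if $X$ has only positive occurrences in each $A_k$ and only negative occurrences in $B$; ($\{\mu X.\}$, $\{\nu X.\}$: the binder is written only if $X$ occurs in some $A_{jk}$, resp. $A_k$); together with: $A\Rightarrow(B\Rightarrow C)\equiv B\Rightarrow(A\Rightarrow C)$; $\forall X.\forall Y.A\equiv\forall Y.\forall X.A$; $A\equiv\forall X.A$ and $A\Rightarrow\forall X.B\equiv\forall X.(A\Rightarrow B)$ for $X$ not free in $A$; $A\times1\equiv A$; $1\Rightarrow A\equiv A$; associativity and commutativity of $\times$; $(A\times B)\Rightarrow C\equiv A\Rightarrow(B\Rightarrow C)$; $A\Rightarrow(B\times C)\equiv(A\Rightarrow B)\times(A\Rightarrow C)$; $\forall X.(A\times B)\equiv\forall X.A\times\forall X.B$; $A+0\equiv A$; $A\times0\equiv0$; $0\Rightarrow A\equiv1$; associativity and commutativity of $+$; $A\times(B+C)\equiv(A\times B)+(A\times C)$; $(A+B)\Rightarrow C\equiv(A\Rightarrow C)\times(B\Rightarrow C)$; $\mu X.A\equiv\nu X.A\equiv A$ for $X$ not free in $A$; $\mu X.A\equiv A[\mu X.A/X]$; $\nu X.A\equiv A[\nu X.A/X]$. **Trees.** Every $\mathsf{\Lambda2}$-type can be put in normal form $\forall\vec Y.A_1\Rightarrow\dots\Rightarrow A_n\Rightarrow X$, with each variable of $\vec Y$ occurring in $A_1\Rightarrow\dots\Rightarrow A_n\Rightarrow X$ and the $A_i$ in normal form, by deleting vacuous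 quantifiers and using $A\Rightarrow\forall X.B\equiv\forall X.(A\Rightarrow B)$; this is unique up to order of quantifiers and arguments. Colors are $c\in\{\mathrm{blue},\mathrm{red}\}$, $\overline c$ is the other color, and $X^c$ is the variable $X$ with color $c$. For a type $A$ with normal form $\forall\vec Y.A_1\Rightarrow\dots\Rightarrow A_n\Rightarrow X$, $\mathsf t^c(A)$ is the rooted tree with root labelled by the set $\vec Y$, whose immediate successors are the roots of $\mathsf t^{\overline c}(A_1),\dots,\mathsf t^{\overline c}(A_n)$ and a terminal node labelled $X^c$, called the *head* of the tree. When an argument $A_i$ is just a variable $Z$, its tree is drawn as a single terminal node labelled $Z^{\overline c}$, except that if $Z$ is quantified at that same root ($Z\in\vec Y$) it is kept in the expanded form: a node labelled $\emptyset$ whose only successor is the terminal node $Z^{\overline c}$. Put $\mathsf t(A)=\mathsf t^{\mathrm{blue}}(A)$. Bound variables are assumed pairwise distinct; for a bound variable $X$, $\mathsf r_X$ is the unique node whose label contains $X$ and $\mathsf h_X$ is the head of the subtree rooted at $\mathsf r_X$. **Coherence.** Two distinct nodes are *parallel* if they are immediate successors of the same node; $d(\alpha,\beta)$ is the number of edges of the path from $\alpha$ to $\beta$. For a bound variable $X$, a terminal node $\alpha$ labelled $X^c$ is *modular* if $\alpha\ne\mathsf h_X$, $1\le d(\alpha,\mathsf r_X)\le2$, and $\alpha$ has no parallel node labelled $X^c$. $X$ is *$c$-eliminable* if every node labelled $X^{\overline c}$ is modular. For bound variables $X,Y$ and colors $c,d$, $X^c$ and $Y^d$ are *coherent* if there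 are no parallel modular nodes $\alpha$ labelled $X^{\overline c}$ and $\beta$ labelled $Y^{\overline d}$. A tree is *coherent* if there is a map $\phi$ from its bound variables to colors such that every bound variable $X$ is $\phi(X)$-eliminable and, for all distinct bound variables $X,Y$, $X^{\phi(X)}$ and $Y^{\phi(Y)}$ are coherent. **Characteristic.** Let $\preceq$ be the tree order with the root as minimum. A *down-move* is a pair of nodes $(\alpha,\beta)$ such that, for some bound variable $X$, $\alpha$ and $\beta$ are labelled by $X$ with opposite colors and $\beta$ is modular. An *up-move* is a pair $(\alpha,\beta)$ with $\alpha\ne\beta$, $\alpha$ modular with immediate predecessor $\gamma$, $\beta$ a terminal node labelled (in either color) by a bound variable, and $\gamma\preceq\beta$. An *alternating path* is a sequence $\alpha_0\dots\alpha_{2n}$ where each $(\alpha_{2i},\alpha_{2i+1})$ is a down-move and each $(\alpha_{2i+1},\alpha_{2i+2})$ is an up-move; it is cyclic if $n\ge1$ and $\alpha_0=\alpha_{2n}$. The characteristic of a tree is $0$ if it is coherent and has no cyclic alternating path, $1$ if it is coherent and has a cyclic alternating path, and $\infty$ if it is not coherent. For a $\mathsf{\Lambda2}$-type $A$, $\kappa(A)$ is the characteristic of $\mathsf t(A)$. -}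

module Defs where

open import Data.Bool.Base using (if_then_else_)
open import Data.Fin.Base using (Fin; zero; suc; _↑ʳ_; punchOut)
import Data.Fin.Properties as Fin
open import Data.List.Base using (List; []; _∷_; _∷ʳ_; _++_; foldr; map; length; head; drop)
import Data.List.Properties as List
open import Data.List.Membership.Propositional using (_∈_)
open import Data.List.Relation.Unary.All using (All)
open import Data.Maybe.Base as Maybe using (Maybe; just; nothing; _>>=_; fromMaybe)
open import Data.Nat.Base using (ℕ; zero; suc; _+_; _≤_)
import Data.Nat.Properties as ℕ
open import Data.Product.Base using (∃; ∃-syntax; Σ-syntax; _×_; _,_)
import Data.Product.Properties as Product
open import Data.Sign.Base using (Sign; opposite)
open import Data.Vec.Base as Vec using (Vec; lookup)
open import Relation.Binary.Definitions using (DecidableEquality)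
open import Relation.Binary.PropositionalEquality.Core using (_≡_; _≢_)
open import Relation.Nullary.Decidable.Core using (does; yes; no)
open import Relation.Nullary.Negation.Core using (¬_)

------------------------------------------------------------------------
-- Types

infixr 5 _⇒_ _⇒*_
infixl 6 _⊕_
infixl 7 _⊗_

-- De Bruijn syntax over n free variables: renaming of bound variables is
-- syntactic identity.  The positivity restriction on μ and ν is the
-- predicate WF below.
data Ty (n : ℕ) : Set where
  var     : Fin n → Ty n
  _⇒_     : Ty n → Ty n → Ty n
  all     : Ty (suc n) → Ty n
  𝟘 𝟙     : Ty n
  _⊕_ _⊗_ : Ty n → Ty n → Ty n
  μ ν     : Ty (suc n) → Ty n

data Λ2 {n : ℕ} : Ty n → Set where
  var : (x : Fin n) → Λ2 (var x)
  _⇒_ : {A B : Ty n} → Λ2 A → Λ2 B → Λ2 (A ⇒ B)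
  all : {A : Ty (suc n)} → Λ2 A → Λ2 (all A)

-- Occ s x A: the variable x has a free occurrence of sign s in A.
data Occ {n : ℕ} : Sign → Fin n → Ty n → Set where
  here : ∀ {x} → Occ Sign.+ x (var x)
  dom  : ∀ {s x A B} → Occ (opposite s) x A → Occ s x (A ⇒ B)
  cod  : ∀ {s x A B} → Occ s x B → Occ s x (A ⇒ B)
  all  : ∀ {s x A} → Occ s (suc x) A → Occ s x (all A)
  ⊕ˡ   : ∀ {s x A B} → Occ s x A → Occ s x (A ⊕ B)
  ⊕ʳ   : ∀ {s x A B} → Occ s x B → Occ s x (A ⊕ B)
  ⊗ˡ   : ∀ {s x A B} → Occ s x A → Occ s x (A ⊗ B)
  ⊗ʳ   : ∀ {s x A B} → Occ s x B → Occ s x (A ⊗ B)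
  μ    : ∀ {s x A} → Occ s (suc x) A → Occ s x (μ A)
  ν    : ∀ {s x A} → Occ s (suc x) A → Occ s x (ν A)

OnlyPos OnlyNeg : {n : ℕ} → Fin n → Ty n → Set
OnlyPos x A = ∀ {s} → Occ s x A → s ≡ Sign.+
OnlyNeg x A = ∀ {s} → Occ s x A → s ≡ Sign.-

data WF {n : ℕ} : Ty n → Set where
  var : (x : Fin n) → WF (var x)
  _⇒_ : ∀ {A B} → WF A → WF B → WF (A ⇒ B)
  all : ∀ {A} → WF A → WF (all A)
  𝟘   : WF 𝟘
  𝟙   : WF 𝟙
  _⊕_ : ∀ {A B} → WF A → WF B → WF (A ⊕ B)
  _⊗_ : ∀ {A B} → WF A → WF B → WF (A ⊗ B)
  μ   : ∀ {A} → OnlyPos zero A → WF A → WF (μ A)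
  ν   : ∀ {A} → OnlyPos zero A → WF A → WF (ν A)

------------------------------------------------------------------------
-- Renaming and substitution

ext : ∀ {m n} → (Fin m → Fin n) → Fin (suc m) → Fin (suc n)
ext ρ zero    = zero
ext ρ (suc x) = suc (ρ x)

ext* : ∀ {m n} k → (Fin m → Fin n) → Fin (k + m) → Fin (k + n)
ext* zero    ρ = ρ
ext* (suc k) ρ = ext (ext* k ρ)

ren : ∀ {m n} → (Fin m → Fin n) → Ty m → Ty n
ren ρ (var x) = var (ρ x)
ren ρ (A ⇒ B) = ren ρ A ⇒ ren ρ B
ren ρ (all A) = all (ren (ext ρ) A)
ren ρ 𝟘       = 𝟘
ren ρ 𝟙       = 𝟙
ren ρ (A ⊕ B) = ren ρ A ⊕ ren ρ B
ren ρ (A ⊗ B) = ren ρ A ⊗ ren ρ B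
ren ρ (μ A)   = μ (ren (ext ρ) A)
ren ρ (ν A)   = ν (ren (ext ρ) A)

wk : ∀ {n} → Ty n → Ty (suc n)
wk = ren suc

exts : ∀ {m n} → (Fin m → Ty n) → Fin (suc m) → Ty (suc n)
exts σ zero    = var zero
exts σ (suc x) = wk (σ x)

sub : ∀ {m n} → (Fin m → Ty n) → Ty m → Ty n
sub σ (var x) = σ x
sub σ (A ⇒ B) = sub σ A ⇒ sub σ B
sub σ (all A) = all (sub (exts σ) A)
sub σ 𝟘       = 𝟘
sub σ 𝟙       = 𝟙
sub σ (A ⊕ B) = sub σ A ⊕ sub σ B
sub σ (A ⊗ B) = sub σ A ⊗ sub σ B
sub σ (μ A)   = μ (sub (exts σ) A)
sub σ (ν A)   = ν (sub (exts σ) A)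

infix 8 _[_]

_[_] : ∀ {n} → Ty (suc n) → Ty n → Ty n
B [ C ] = sub (λ { zero → C ; (suc x) → var x }) B

swap : ∀ {n} → Fin (suc (suc n)) → Fin (suc (suc n))
swap zero          = suc zero
swap (suc zero)    = zero
swap (suc (suc x)) = suc (suc x)

-- Moves the innermost variable outwards past the m variables below it,
-- keeping the order of the other variables.
past : ∀ m {n} → Fin (suc (m + n)) → Fin (m + suc n)
past zero    x             = x
past (suc m) zero          = suc (past m zero)
past (suc m) (suc zero)    = zero
past (suc m) (suc (suc x)) = suc (past m (suc x))

------------------------------------------------------------------------
-- Derived type formers

all* : ∀ {n} k → Ty (k + n) → Ty n
all* zero    A = A
all* (suc k) A = all* k (all A)

_⇒*_ : ∀ {n} → List (Ty n) → Ty n → Ty n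
As ⇒* B = foldr _⇒_ B As

-- ∀Y′. (∀Y₁…Yₖ. A ⇒ Y′) ⇒ Y′ for k ≥ 1.
ex* : ∀ {n} k → Ty (k + n) → Ty n
ex* zero      A = A
ex* k@(suc _) A =
  all (all* k (ren (ext* k suc) A ⇒ var (k ↑ʳ zero)) ⇒ var zero)

Sum Prod : ∀ {n} → List (Ty n) → Ty n
Sum []           = 𝟘
Sum (A ∷ [])     = A
Sum (A ∷ B ∷ As) = A ⊕ Sum (B ∷ As)
Prod []           = 𝟙
Prod (A ∷ [])     = A
Prod (A ∷ B ∷ As) = A ⊗ Prod (B ∷ As)

-- 0 + 1 + … + 1 with k copies of 1.
ones : ∀ {n} → ℕ → Ty n
ones zero    = 𝟘
ones (suc k) = ones k ⊕ 𝟙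

-- The optional binders {μX.} and {νX.}: Opt μ C D says that D is μX.C if X
-- (variable zero) occurs in C, and is C itself otherwise.
data Opt {n : ℕ} (fix : Ty (suc n) → Ty n) : Ty (suc n) → Ty n → Set where
  binder    : ∀ {s C} → Occ s zero C → Opt fix C (fix C)
  no-binder : ∀ {C} → Opt fix (wk C) C

------------------------------------------------------------------------
-- The congruence ≡Y

-- The data of an argument ∀Z⃗ₖ.⟨Aⱼₖ⟩ⱼ⇒X of (Y+), resp. ∀Z⃗ₖ.X⇒Aₖ of (Y−);
-- X is variable zero of the scope outside Z⃗ₖ.
record Clause⁺ (n : ℕ) : Set where
  constructor clause⁺
  field
    arity : ℕ
    prems : List (Ty (arity + suc n))

  arg : Ty (suc n)
  arg = all* arity (prems ⇒* var (arity ↑ʳ zero))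

  summand : Ty (suc n)
  summand = ex* arity (Prod prems)

  Positive : Set
  Positive = All (OnlyPos (arity ↑ʳ zero)) prems

record Clause⁻ (n : ℕ) : Set where
  constructor clause⁻
  field
    arity : ℕ
    concl : Ty (arity + suc n)

  arg : Ty (suc n)
  arg = all* arity (var (arity ↑ʳ zero) ⇒ concl)

  factor : Ty (suc n)
  factor = all* arity concl

  Positive : Set
  Positive = OnlyPos (arity ↑ʳ zero) concl

infix 4 _▷_ _≡Y_

-- In Y⁺ and Y⁻ the m variables Y⃗ are bound inside X on the left-hand side,
-- while clauses and B are given with X innermost; past m restores the order
-- ∀X.∀Y⃗.
data _▷_ {n : ℕ} : Ty n → Ty n → Set where
  Y⁺ : ∀ m (Ks : List (Clause⁺ (m + n))) (B : Ty (suc (m + n))) {C} →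
       All Clause⁺.Positive Ks → OnlyPos zero B →
       Opt μ (Sum (map Clause⁺.summand Ks)) C →
       all (all* m (ren (past m) (map Clause⁺.arg Ks ⇒* B))) ▷ all* m (B [ C ])
  Y⁻ : ∀ m (Ks : List (Clause⁻ (m + n))) (B : Ty (suc (m + n))) {C} →
       All Clause⁻.Positive Ks → OnlyNeg zero B →
       Opt ν (Prod (map Clause⁻.factor Ks)) C →
       all (all* m (ren (past m) (map Clause⁻.arg Ks ⇒* B))) ▷ all* m (B [ C ])

  ⇒-exch   : ∀ A B C → A ⇒ (B ⇒ C) ▷ B ⇒ (A ⇒ C)
  all-exch : ∀ A → all (all A) ▷ all (all (ren swap A))
  all-vac  : ∀ A → A ▷ all (wk A)
  ⇒-all    : ∀ A B → A ⇒ all B ▷ all (wk A ⇒ B)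

  ⊗-unit  : ∀ A → A ⊗ 𝟙 ▷ A
  𝟙-⇒     : ∀ A → 𝟙 ⇒ A ▷ A
  ⊗-assoc : ∀ A B C → (A ⊗ B) ⊗ C ▷ A ⊗ (B ⊗ C)
  ⊗-comm  : ∀ A B → A ⊗ B ▷ B ⊗ A
  ⊗-⇒     : ∀ A B C → (A ⊗ B) ⇒ C ▷ A ⇒ (B ⇒ C)
  ⇒-⊗     : ∀ A B C → A ⇒ (B ⊗ C) ▷ (A ⇒ B) ⊗ (A ⇒ C)
  all-⊗   : ∀ A B → all (A ⊗ B) ▷ all A ⊗ all B
  ⊕-unit  : ∀ A → A ⊕ 𝟘 ▷ A
  ⊗-zero  : ∀ A → A ⊗ 𝟘 ▷ 𝟘
  𝟘-⇒     : ∀ A → 𝟘 ⇒ A ▷ 𝟙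
  ⊕-assoc : ∀ A B C → (A ⊕ B) ⊕ C ▷ A ⊕ (B ⊕ C)
  ⊕-comm  : ∀ A B → A ⊕ B ▷ B ⊕ A
  ⊗-⊕     : ∀ A B C → A ⊗ (B ⊕ C) ▷ (A ⊗ B) ⊕ (A ⊗ C)
  ⊕-⇒     : ∀ A B C → (A ⊕ B) ⇒ C ▷ (A ⇒ C) ⊗ (B ⇒ C)

  μ-vac  : ∀ A → μ (wk A) ▷ A
  ν-vac  : ∀ A → ν (wk A) ▷ A
  μ-fold : ∀ A → μ A ▷ A [ μ A ]
  ν-fold : ∀ A → ν A ▷ A [ ν A ]

-- The premises WF make this a relation between well-formed types only.
data _≡Y_ {n : ℕ} : Ty n → Ty n → Set where
  axiom : ∀ {A B} → WF A → WF B → A ▷ B → A ≡Y B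
  refl  : ∀ {A} → WF A → A ≡Y A
  sym   : ∀ {A B} → A ≡Y B → B ≡Y A
  trans : ∀ {A B C} → A ≡Y B → B ≡Y C → A ≡Y C
  _⇒_   : ∀ {A A′ B B′} → A ≡Y A′ → B ≡Y B′ → A ⇒ B ≡Y A′ ⇒ B′
  all   : ∀ {A A′} → A ≡Y A′ → all A ≡Y all A′
  _⊕_   : ∀ {A A′ B B′} → A ≡Y A′ → B ≡Y B′ → A ⊕ B ≡Y A′ ⊕ B′
  _⊗_   : ∀ {A A′ B B′} → A ≡Y A′ → B ≡Y B′ → A ⊗ B ≡Y A′ ⊗ B′
  μ     : ∀ {A A′} → OnlyPos zero A → OnlyPos zero A′ → A ≡Y A′ → μ A ≡Y μ A′
  ν     : ∀ {A A′} → OnlyPos zero A → OnlyPos zero A′ → A ≡Y A′ → ν A ≡Y ν A′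

------------------------------------------------------------------------
-- Normal forms of Λ2-types

infix 5 _⇛_

-- A prefix of quantifiers followed by A₁ ⇒ … ⇒ Aₙ ⇒ X, written As ⇛ X.
data NF (n : ℕ) : Set where
  all : NF (suc n) → NF n
  _⇛_ : List (NF n) → Fin n → NF n

renNF  : ∀ {m n} → (Fin m → Fin n) → NF m → NF n
renNFs : ∀ {m n} → (Fin m → Fin n) → List (NF m) → List (NF n)
renNF ρ (all A)   = all (renNF (ext ρ) A)
renNF ρ (As ⇛ x)  = renNFs ρ As ⇛ ρ x
renNFs ρ []       = []
renNFs ρ (A ∷ As) = renNF ρ A ∷ renNFs ρ As

-- Removes the variable x from the scope; nothing if x occurs.
strengthen  : ∀ {n} → Fin (suc n) → NF (suc n) → Maybe (NF n)
strengthens : ∀ {n} → Fin (suc n) → List (NF (suc n)) → Maybe (List (NF n))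
strengthen x (all A) = Maybe.map all (strengthen (suc x) A)
strengthen x (As ⇛ y) with x Fin.≟ y
... | yes _  = nothing
... | no x≢y = Maybe.map (_⇛ punchOut x≢y) (strengthens x As)
strengthens x []       = just []
strengthens x (A ∷ As) = strengthen x A >>= λ A′ → Maybe.map (A′ ∷_) (strengthens x As)

-- A ⇒ ∀Y⃗.(As ⇒ X) becomes ∀Y⃗.(A ⇒ As ⇒ X).
arrow : ∀ {n} → NF n → NF n → NF n
arrow A (all B)  = all (arrow (renNF suc A) B)
arrow A (As ⇛ x) = (A ∷ As) ⇛ x

quantify : ∀ {n} → NF (suc n) → NF n
quantify A = fromMaybe (all A) (strengthen zero A)

nf : ∀ {n} {A : Ty n} → Λ2 A → NF n
nf (var x) = [] ⇛ x
nf (A ⇒ B) = arrow (nf A) (nf B)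
nf (all A) = quantify (nf A)

------------------------------------------------------------------------
-- Trees

data Color : Set where
  blue red : Color

other : Color → Color
other blue = red
other red  = blue

-- A node is the list of successor indices leading to it from the root.
Node : Set
Node = List ℕ

-- Bound variables are made pairwise distinct by naming the i-th variable of
-- the label of node r as (r , i).
Name : Set
Name = Node × ℕ

_≟ᴺ_ : DecidableEquality Name
_≟ᴺ_ = Product.≡-dec (List.≡-dec ℕ._≟_) ℕ._≟_

open import Data.List.Membership.DecPropositional _≟ᴺ_ using (_∈?_)

-- A terminal node, or a node with its label and its immediate successors.
-- Among the latter the head is listed first.
data Tree : Set where
  leaf : Name → Color → Tree
  node : List Name → List Tree → Tree

-- tree c p ρ ys A is the subtree at node p for A, where ρ names the free
-- variables of A and ys is the part of the label collected so far;
-- argTree c p ρ ys A is the tree, at node p and with root color c, for an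
-- argument A of a node labelled ys.
tree     : ∀ {n} → Color → Node → Vec Name n → List Name → NF n → Tree
argTree  : ∀ {n} → Color → Node → Vec Name n → List Name → NF n → Tree
argTrees : ∀ {n} → Color → Node → Vec Name n → List Name → ℕ → List (NF n) → List Tree

tree c p ρ ys (all A)  = let Y = (p , length ys) in tree c p (Y Vec.∷ ρ) (ys ∷ʳ Y) A
tree c p ρ ys (As ⇛ x) = node ys (leaf (lookup ρ x) c ∷ argTrees c p ρ ys 1 As)

argTree c p ρ ys ([] ⇛ z) =
  if does (lookup ρ z ∈? ys)
  then node [] (leaf (lookup ρ z) c ∷ [])
  else leaf (lookup ρ z) c
argTree c p ρ ys A = tree c p ρ [] A

argTrees c p ρ ys i []       = []
argTrees c p ρ ys i (A ∷ As) =
  argTree (other c) (p ∷ʳ i) ρ ys A ∷ argTrees c p ρ ys (suc i) As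

t : {A : Ty 0} → Λ2 A → Tree
t A = tree blue [] Vec.[] [] (nf A)

------------------------------------------------------------------------
-- Nodes of a tree

infixl 5 _at_

_at_ : Tree → Node → Maybe Tree
T         at []      = just T
leaf _ _  at (_ ∷ _) = nothing
node _ Ts at (i ∷ p) = head (drop i Ts) >>= (_at p)

Labelled : Tree → Node → Name → Color → Set
Labelled T α X c = T at α ≡ just (leaf X c)

-- r is the node r_X whose label contains X.
BoundAt : Tree → Name → Node → Set
BoundAt T X r = ∃[ ys ] ∃[ Ts ] T at r ≡ just (node ys Ts) × X ∈ ys

Bound : Tree → Name → Set
Bound T X = ∃ (BoundAt T X)

headOf : Node → Node
headOf r = r ∷ʳ 0

ImmSucc : Node → Node → Set
ImmSucc γ α = ∃[ i ] α ≡ γ ∷ʳ i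

Parallel : Node → Node → Set
Parallel α β = α ≢ β × ∃[ γ ] ImmSucc γ α × ImmSucc γ β

infix 4 _≼_

_≼_ : Node → Node → Set
γ ≼ β = ∃[ δ ] β ≡ γ ++ δ

-- Length of the path joining two nodes, through their last common ancestor.
d : Node → Node → ℕ
d []      q       = length q
d (i ∷ p) []      = length (i ∷ p)
d (i ∷ p) (j ∷ q) =
  if does (i ℕ.≟ j) then d p q else length (i ∷ p) + length (j ∷ q)

------------------------------------------------------------------------
-- Coherence

record Modular (T : Tree) (X : Name) (c : Color) (α : Node) : Set where
  field
    labelled : Labelled T α X c
    r        : Node
    boundAt  : BoundAt T X r
    not-head : α ≢ headOf r
    1≤d      : 1 ≤ d α r
    d≤2      : d α r ≤ 2
    unique   : ∀ β → Parallel α β → ¬ Labelled T β X c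

Eliminable : Tree → Name → Color → Set
Eliminable T X c = ∀ α → Labelled T α X (other c) → Modular T X (other c) α

CoherentVars : Tree → Name → Color → Name → Color → Set
CoherentVars T X c Y e =
  ¬ (∃[ α ] ∃[ β ] Parallel α β × Modular T X (other c) α × Modular T Y (other e) β)

-- Only the values of φ on the bound variables of T matter.
Coherent : Tree → Set
Coherent T = Σ[ φ ∈ (Name → Color) ]
    (∀ X → Bound T X → Eliminable T X (φ X))
  × (∀ X Y → Bound T X → Bound T Y → X ≢ Y → CoherentVars T X (φ X) Y (φ Y))

------------------------------------------------------------------------
-- Characteristic

DownMove : Tree → Node → Node → Set
DownMove T α β = ∃[ X ] ∃[ c ]
  Bound T X × Labelled T α X c × Labelled T β X (other c) × Modular T X (other c) β

UpMove : Tree → Node → Node → Set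
UpMove T α β =
    α ≢ β
  × (∃[ X ] ∃[ c ] Modular T X c α)
  × (∃[ Y ] ∃[ e ] Bound T Y × Labelled T β Y e)
  × (∃[ γ ] ImmSucc γ α × γ ≼ β)

-- AltPath T n α₀ α₂ₙ
data AltPath (T : Tree) : ℕ → Node → Node → Set where
  []   : ∀ {α} → AltPath T 0 α α
  step : ∀ {n α β γ δ} → DownMove T α β → UpMove T β γ → AltPath T n γ δ →
         AltPath T (suc n) α δ

HasCycle : Tree → Set
HasCycle T = ∃[ n ] ∃[ α ] 1 ≤ n × AltPath T n α α

data Char : Set where
  c0 c1 c∞ : Char

-- The graph of the characteristic, as a relation between trees and values.
data HasChar (T : Tree) : Char → Set where
  zero : Coherent T → ¬ HasCycle T → HasChar T c0
  one  : Coherent T → HasCycle T → HasChar T c1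
  inf  : ¬ Coherent T → HasChar T c∞

infix 4 κ_≈_

κ_≈_ : {A : Ty 0} → Λ2 A → Char → Set
κ A ≈ χ = HasChar (t A) χ

-- Let φ witness coherence.  Quantifiers are removed innermost first.  When X,
-- quantified at a node p, is next, the types inside the arguments of p are
-- already binder-free, so the arguments with a child labelled X of the color
-- opposite to φ X are the clauses of (Y+) or (Y−), according to whether φ X is
-- the color of p; eliminability says that X has the required sign elsewhere, and
-- coherence that no other variable competes for the same argument.  Every
-- occurrence of a variable in an intermediate type is the endpoint of an
-- alternating path, so an occurrence of X in the body of its own clauses would
-- close a cycle.  Hence no μ or ν arises and what remains at the end is a
-- closed type over ⇒, 0, 1, + and ×, which evaluates to a numeral.
module Submission where

open import Defs
open import Data.Empty using (⊥; ⊥-elim)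
open import Data.Fin.Base using (Fin; zero; suc; punchIn)
import Data.Fin.Properties as Fin
open import Data.List.Base using (List; []; _∷_; _∷ʳ_; _++_; map; length; head; drop; filter)
import Data.List.Properties as List
open import Data.List.Membership.Propositional using (_∈_; _∉_)
open import Data.List.Membership.DecPropositional _≟ᴺ_ using (_∈?_)
open import Data.List.Relation.Binary.Permutation.Propositional as Perm using (_↭_)
import Data.List.Relation.Binary.Permutation.Propositional.Properties as Perm
open import Data.List.Relation.Unary.All as All using (All; []; _∷_)
import Data.List.Relation.Unary.All.Properties as All
open import Data.List.Relation.Unary.AllPairs as AllPairs using (AllPairs; []; _∷_)
import Data.List.Relation.Unary.AllPairs.Properties as AllPairs
open import Data.List.Relation.Unary.Any as Any using (Any; here; there)
import Data.List.Relation.Unary.Any.Properties as Any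
open import Data.Maybe.Base as Maybe using (Maybe; just; nothing; _>>=_)
import Data.Maybe.Properties as Maybe
open import Data.Nat.Base using (ℕ; zero; suc; _+_; _≤_; _<_; z≤n; s≤s)
import Data.Nat.Properties as ℕ
open import Data.Product.Base using (∃; ∃₂; ∃-syntax; _×_; _,_; proj₁; proj₂; map₂)
open import Data.Sign.Base as Sign using (Sign; opposite)
open import Data.Sum.Base as Sum using (_⊎_; inj₁; inj₂)
open import Data.Vec.Base as Vec using (Vec; lookup)
open import Function.Base using (_∘_; id; case_of_)
open import Relation.Binary.PropositionalEquality as ≡ using (_≡_; _≢_; refl; cong; cong₂; subst)
open import Relation.Nullary using (¬_; Dec; yes; no; ¬?; contradiction)
open import Relation.Nullary.Decidable using (dec-true; _⊎-dec_)
open import Relation.Unary using (Decidable)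

-- Binder-free types

data Mono {n : ℕ} : Ty n → Set where
  var : (x : Fin n) → Mono (var x)
  _⇒_ : ∀ {A B} → Mono A → Mono B → Mono (A ⇒ B)
  𝟘   : Mono 𝟘
  𝟙   : Mono 𝟙
  _⊕_ : ∀ {A B} → Mono A → Mono B → Mono (A ⊕ B)
  _⊗_ : ∀ {A B} → Mono A → Mono B → Mono (A ⊗ B)

mono⇒wf : ∀ {n} {A : Ty n} → Mono A → WF A
mono⇒wf (var x) = var x
mono⇒wf (A ⇒ B) = mono⇒wf A ⇒ mono⇒wf B
mono⇒wf 𝟘       = 𝟘
mono⇒wf 𝟙       = 𝟙
mono⇒wf (A ⊕ B) = mono⇒wf A ⊕ mono⇒wf B
mono⇒wf (A ⊗ B) = mono⇒wf A ⊗ mono⇒wf B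

[]-mono : ∀ {n} {A : Ty (suc n)} {C : Ty n} → Mono A → Mono C → Mono (A [ C ])
[]-mono (var zero)    c = c
[]-mono (var (suc x)) c = var x
[]-mono (A ⇒ B) c = []-mono A c ⇒ []-mono B c
[]-mono 𝟘       c = 𝟘
[]-mono 𝟙       c = 𝟙
[]-mono (A ⊕ B) c = []-mono A c ⊕ []-mono B c
[]-mono (A ⊗ B) c = []-mono A c ⊗ []-mono B c

ren-id : ∀ {n} {ρ : Fin n → Fin n} {A : Ty n} → (∀ x → ρ x ≡ x) → Mono A → ren ρ A ≡ A
ren-id ρ≗id (var x) = cong var (ρ≗id x)
ren-id ρ≗id (A ⇒ B) = cong₂ _⇒_ (ren-id ρ≗id A) (ren-id ρ≗id B)
ren-id ρ≗id 𝟘       = refl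
ren-id ρ≗id 𝟙       = refl
ren-id ρ≗id (A ⊕ B) = cong₂ _⊕_ (ren-id ρ≗id A) (ren-id ρ≗id B)
ren-id ρ≗id (A ⊗ B) = cong₂ _⊗_ (ren-id ρ≗id A) (ren-id ρ≗id B)

-- Free occurrences under renaming and substitution

NoOcc : ∀ {n} → Fin n → Ty n → Set
NoOcc x A = ∀ s → ¬ Occ s x A

dom-opposite : ∀ {n s} {x : Fin n} {A B} → Occ s x A → Occ (opposite s) x (A ⇒ B)
dom-opposite {s = Sign.+} o = dom o
dom-opposite {s = Sign.-} o = dom o

occ-ren : ∀ {m n s} {ρ : Fin m → Fin n} {x A} → Occ s x A → Occ s (ρ x) (ren ρ A)
occ-ren here    = here
occ-ren (dom o) = dom (occ-ren o)
occ-ren (cod o) = cod (occ-ren o)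
occ-ren {ρ = ρ} (all o) = all (occ-ren {ρ = ext ρ} o)
occ-ren (⊕ˡ o)  = ⊕ˡ (occ-ren o)
occ-ren (⊕ʳ o)  = ⊕ʳ (occ-ren o)
occ-ren (⊗ˡ o)  = ⊗ˡ (occ-ren o)
occ-ren (⊗ʳ o)  = ⊗ʳ (occ-ren o)
occ-ren {ρ = ρ} (μ o) = μ (occ-ren {ρ = ext ρ} o)
occ-ren {ρ = ρ} (ν o) = ν (occ-ren {ρ = ext ρ} o)

-- Substituting for an absent variable serves as strengthening, with `𝟙` as an arbitrary filler. The
-- equation exhibits the type as a weakening, the form that `no-binder` demands.
wk-[𝟙] : ∀ {n} {A : Ty (suc n)} → Mono A → NoOcc zero A → wk (A [ 𝟙 ]) ≡ A
wk-[𝟙] (var zero)    ∌0 = contradiction here (∌0 _)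
wk-[𝟙] (var (suc x)) ∌0 = refl
wk-[𝟙] (A ⇒ B) ∌0 =
  cong₂ _⇒_ (wk-[𝟙] A (λ s → ∌0 _ ∘ dom-opposite)) (wk-[𝟙] B (λ s → ∌0 s ∘ cod))
wk-[𝟙] 𝟘       ∌0 = refl
wk-[𝟙] 𝟙       ∌0 = refl
wk-[𝟙] (A ⊕ B) ∌0 = cong₂ _⊕_ (wk-[𝟙] A (λ s → ∌0 s ∘ ⊕ˡ)) (wk-[𝟙] B (λ s → ∌0 s ∘ ⊕ʳ))
wk-[𝟙] (A ⊗ B) ∌0 = cong₂ _⊗_ (wk-[𝟙] A (λ s → ∌0 s ∘ ⊗ˡ)) (wk-[𝟙] B (λ s → ∌0 s ∘ ⊗ʳ))

data SubOcc {n} (s : Sign) (y : Fin n) (A : Ty (suc n)) (C : Ty n) : Set where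
  outer : Occ s (suc y) A → SubOcc s y A C
  inner : ∀ {s₁ s₂} → s₁ Sign.* s₂ ≡ s → Occ s₁ zero A → Occ s₂ y C → SubOcc s y A C

opposite-* : ∀ {s} s₁ s₂ → s₁ Sign.* s₂ ≡ opposite s → opposite s₁ Sign.* s₂ ≡ s
opposite-* {Sign.+} Sign.+ Sign.- eq = refl
opposite-* {Sign.+} Sign.- Sign.+ eq = refl
opposite-* {Sign.-} Sign.+ Sign.+ eq = refl
opposite-* {Sign.-} Sign.- Sign.- eq = refl

occ-[] : ∀ {n s} {y : Fin n} {A C} → Mono A → Occ s y (A [ C ]) → SubOcc s y A C
occ-[] {C = C} M = go M
  where
  lift : ∀ {s y A A′} → (∀ {s x} → Occ s x A → Occ s x A′) → SubOcc s y A C → SubOcc s y A′ C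
  lift f (outer o)      = outer (f o)
  lift f (inner e o o′) = inner e (f o) o′

  go : ∀ {s y A} → Mono A → Occ s y (A [ C ]) → SubOcc s y A C
  go (var zero) o       = inner refl here o
  go (var (suc x)) here = outer here
  go (A ⇒ B) (dom o) with go A o
  ... | outer o′ = outer (dom o′)
  ... | inner {s₁} {s₂} e o′ o″ = inner (opposite-* s₁ s₂ e) (dom-opposite o′) o″
  go (A ⇒ B) (cod o) = lift cod (go B o)
  go (A ⊕ B) (⊕ˡ o)  = lift ⊕ˡ (go A o)
  go (A ⊕ B) (⊕ʳ o)  = lift ⊕ʳ (go B o)
  go (A ⊗ B) (⊗ˡ o)  = lift ⊗ˡ (go A o)
  go (A ⊗ B) (⊗ʳ o)  = lift ⊗ʳ (go B o)

occ-Sum : ∀ {n s} {x : Fin n} As → Occ s x (Sum As) → Any (Occ s x) As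
occ-Sum (A ∷ [])     o      = here o
occ-Sum (A ∷ B ∷ As) (⊕ˡ o) = here o
occ-Sum (A ∷ B ∷ As) (⊕ʳ o) = there (occ-Sum (B ∷ As) o)

occ-Prod : ∀ {n s} {x : Fin n} As → Occ s x (Prod As) → Any (Occ s x) As
occ-Prod (A ∷ [])     o      = here o
occ-Prod (A ∷ B ∷ As) (⊗ˡ o) = here o
occ-Prod (A ∷ B ∷ As) (⊗ʳ o) = there (occ-Prod (B ∷ As) o)

occ-⇒* : ∀ {n s} {x : Fin n} As {B} →
         Occ s x (As ⇒* B) → Any (Occ (opposite s) x) As ⊎ Occ s x B
occ-⇒* []       o       = inj₂ o
occ-⇒* (A ∷ As) (dom o) = inj₁ (here o)
occ-⇒* (A ∷ As) (cod o) = Sum.map₁ there (occ-⇒* As o)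

Sum-mono : ∀ {n} {As : List (Ty n)} → All Mono As → Mono (Sum As)
Sum-mono []           = 𝟘
Sum-mono (A ∷ [])     = A
Sum-mono (A ∷ B ∷ As) = A ⊕ Sum-mono (B ∷ As)

Prod-mono : ∀ {n} {As : List (Ty n)} → All Mono As → Mono (Prod As)
Prod-mono []           = 𝟙
Prod-mono (A ∷ [])     = A
Prod-mono (A ∷ B ∷ As) = A ⊗ Prod-mono (B ∷ As)

⇒*-mono : ∀ {n} {As : List (Ty n)} {B} → All Mono As → Mono B → Mono (As ⇒* B)
⇒*-mono []       b = b
⇒*-mono (a ∷ as) b = a ⇒ ⇒*-mono as b

⇒*-[] : ∀ {n} As {B : Ty (suc n)} {C} → (As ⇒* B) [ C ] ≡ map (_[ C ]) As ⇒* (B [ C ])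
⇒*-[] []       = refl
⇒*-[] (A ∷ As) = cong (_ ⇒_) (⇒*-[] As)

-- Curried arguments up to ≡Y

⇒*-wf : ∀ {n} {As : List (Ty n)} {B} → All WF As → WF B → WF (As ⇒* B)
⇒*-wf []       b = b
⇒*-wf (a ∷ as) b = a ⇒ ⇒*-wf as b

⇒*-↭ : ∀ {n} {As Bs : List (Ty n)} {C} → All WF As → WF C → As ↭ Bs → As ⇒* C ≡Y Bs ⇒* C
⇒*-↭ as c Perm.refl = refl (⇒*-wf as c)
⇒*-↭ (a ∷ as) c (Perm.prep A p) = refl a ⇒ ⇒*-↭ as c p
⇒*-↭ (a ∷ b ∷ as) c (Perm.swap A B p) =
  trans (axiom (a ⇒ b ⇒ w) (b ⇒ a ⇒ w) (⇒-exch A B _)) (refl b ⇒ refl a ⇒ ⇒*-↭ as c p)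
  where w = ⇒*-wf as c
⇒*-↭ as c (Perm.trans p q) = trans (⇒*-↭ as c p) (⇒*-↭ (Perm.All-resp-↭ p as) c q)

⇒*-cong : ∀ {n} {X : Set} {f g : X → Ty n} {xs B B′} →
          All (λ x → f x ≡Y g x) xs → B ≡Y B′ → map f xs ⇒* B ≡Y map g xs ⇒* B′
⇒*-cong []       e = e
⇒*-cong (d ∷ ds) e = d ⇒ ⇒*-cong ds e

++-⇒* : ∀ {n} (As Bs : List (Ty n)) {C} → (As ++ Bs) ⇒* C ≡ As ⇒* (Bs ⇒* C)
++-⇒* []       Bs = refl
++-⇒* (A ∷ As) Bs = cong (A ⇒_) (++-⇒* As Bs)

map-All : ∀ {X Y : Set} {P : Y → Set} {f : X → Y} → (∀ x → P (f x)) → ∀ xs → All P (map f xs)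
map-All h xs = All.map⁺ (All.universal h xs)

opt-no-binder : ∀ {n} {fix : Ty (suc n) → Ty n} {A} → Mono A → NoOcc zero A → Opt fix A (A [ 𝟙 ])
opt-no-binder {fix = fix} {A} a ∌0 = subst (λ D → Opt fix D (A [ 𝟙 ])) (wk-[𝟙] a ∌0) no-binder

-- (Y+) and (Y−) for quantifier-free clauses whose bodies avoid X.

Y⁺₀ : ∀ {n} (Ps : List (List (Ty (suc n)))) {B : Ty (suc n)} →
      All (All Mono) Ps → Mono B → All (All (NoOcc zero)) Ps → OnlyPos zero B →
      (let S = Sum (map Prod Ps)) → NoOcc zero S →
      all (map (_⇒* var zero) Ps ⇒* B) ≡Y B [ S [ 𝟙 ] ]
Y⁺₀ Ps {B} ps b ∌0 pos S∌0 =
  subst (λ A → all A ≡Y B [ C ]) eq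
    (axiom (all (subst WF (≡.sym eq) (mono⇒wf lhs))) (mono⇒wf ([]-mono b c))
      -- The outer block of quantifiers and those inside the clauses are all empty, so no
      -- existential appears and `past 0` is the identity.
      (Y⁺ 0 (map (clause⁺ 0) Ps) B
        (All.map⁺ (All.map (All.map (λ ∌ {_} o → contradiction o (∌ _))) ∌0)) pos
        (subst (λ Ds → Opt μ (Sum Ds) C) (List.map-∘ Ps) (opt-no-binder s S∌0))))
  where
  s = Sum-mono (All.map⁺ (All.map Prod-mono ps))
  C = Sum (map Prod Ps) [ 𝟙 ]
  c = []-mono s 𝟙
  lhs = ⇒*-mono (All.map⁺ (All.map (λ qs → ⇒*-mono qs (var zero)) ps)) b
  eq : ren (past 0) (map Clause⁺.arg (map (clause⁺ 0) Ps) ⇒* B) ≡ map (_⇒* var zero) Ps ⇒* B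
  eq = ≡.trans (cong (λ As → ren (past 0) (As ⇒* B)) (≡.sym (List.map-∘ Ps)))
               (ren-id (λ _ → refl) lhs)

Y⁻₀ : ∀ {n} (As : List (Ty (suc n))) {B : Ty (suc n)} →
      All Mono As → Mono B → All (NoOcc zero) As → OnlyNeg zero B →
      (let P = Prod As) → NoOcc zero P →
      all (map (var zero ⇒_) As ⇒* B) ≡Y B [ P [ 𝟙 ] ]
Y⁻₀ As {B} as b ∌0 neg P∌0 =
  subst (λ A → all A ≡Y B [ C ]) eq
    (axiom (all (subst WF (≡.sym eq) (mono⇒wf lhs))) (mono⇒wf ([]-mono b c))
      (Y⁻ 0 (map (clause⁻ 0) As) B
        (All.map⁺ (All.map (λ ∌ {_} o → contradiction o (∌ _)) ∌0)) neg
        (subst (λ Ds → Opt ν (Prod Ds) C) (≡.trans (≡.sym (List.map-id As)) (List.map-∘ As))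
          (opt-no-binder p P∌0))))
  where
  p = Prod-mono as
  C = Prod As [ 𝟙 ]
  c = []-mono p 𝟙
  lhs = ⇒*-mono (All.map⁺ (All.map (var zero ⇒_) as)) b
  eq : ren (past 0) (map Clause⁻.arg (map (clause⁻ 0) As) ⇒* B) ≡ map (var zero ⇒_) As ⇒* B
  eq = ≡.trans (cong (λ As → ren (past 0) (As ⇒* B)) (≡.sym (List.map-∘ As)))
               (ren-id (λ _ → refl) lhs)

-- Closed binder-free types are numerals

ones-wf : ∀ {n} k → WF {n} (ones k)
ones-wf zero    = 𝟘
ones-wf (suc k) = ones-wf k ⊕ 𝟙

ones-⊕ : ∀ {n} j k → ones {n} j ⊕ ones k ≡Y ones (k + j)
ones-⊕ j zero    = axiom (ones-wf j ⊕ 𝟘) (ones-wf j) (⊕-unit _)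
ones-⊕ j (suc k) =
  trans (sym (axiom ((ones-wf j ⊕ ones-wf k) ⊕ 𝟙) (ones-wf j ⊕ (ones-wf k ⊕ 𝟙)) (⊕-assoc _ _ _)))
        (ones-⊕ j k ⊕ refl 𝟙)

ones-⊗ : ∀ {n} j k → ∃[ l ] (ones {n} j ⊗ ones k ≡Y ones l)
ones-⊗ j zero    = 0 , axiom (ones-wf j ⊗ 𝟘) 𝟘 (⊗-zero _)
ones-⊗ j (suc k) with ones-⊗ j k
... | l , e = j + l , trans (axiom (J ⊗ (K ⊕ 𝟙)) ((J ⊗ K) ⊕ (J ⊗ 𝟙)) (⊗-⊕ _ _ _))
                     (trans (e ⊕ axiom (J ⊗ 𝟙) J (⊗-unit _)) (ones-⊕ l j))
  where
  J = ones-wf j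
  K = ones-wf k

ones-1 : ∀ {n} → 𝟙 ≡Y ones {n} 1
ones-1 = sym (trans (axiom (𝟘 ⊕ 𝟙) (𝟙 ⊕ 𝟘) (⊕-comm _ _)) (axiom (𝟙 ⊕ 𝟘) 𝟙 (⊕-unit _)))

-- Exponentiation by recursion on the exponent: `⊕-⇒` turns a successor into one more factor, and
-- `𝟘-⇒` gives 1 at exponent 0, whatever the base.
ones-⇒ : ∀ {n} j k → ∃[ l ] (ones {n} j ⇒ ones k ≡Y ones l)
ones-⇒ zero    k = 1 , trans (axiom (𝟘 ⇒ ones-wf k) 𝟙 (𝟘-⇒ _)) ones-1
ones-⇒ (suc j) k with ones-⇒ j k
... | l , e with ones-⊗ l k
... | m , e′ = m , trans (axiom ((J ⊕ 𝟙) ⇒ K) ((J ⇒ K) ⊗ (𝟙 ⇒ K)) (⊕-⇒ _ _ _))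
                  (trans (e ⊗ axiom (𝟙 ⇒ K) K (𝟙-⇒ _)) e′)
  where
  J = ones-wf j
  K = ones-wf k

mono-ones : {A : Ty 0} → Mono A → ∃[ k ] (A ≡Y ones k)
mono-ones (A ⇒ B) with mono-ones A | mono-ones B
... | j , e | k , f = map₂ (trans (e ⇒ f)) (ones-⇒ j k)
mono-ones 𝟘 = 0 , refl 𝟘
mono-ones 𝟙 = 1 , ones-1
mono-ones (A ⊕ B) with mono-ones A | mono-ones B
... | j , e | k , f = k + j , trans (e ⊕ f) (ones-⊕ j k)
mono-ones (A ⊗ B) with mono-ones A | mono-ones B
... | j , e | k , f = map₂ (trans (e ⊗ f)) (ones-⊗ j k)

-- Normal forms

⌜_⌝  : ∀ {n} → NF n → Ty n
⌜_⌝* : ∀ {n} → List (NF n) → List (Ty n)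
⌜ all A ⌝  = all ⌜ A ⌝
⌜ As ⇛ x ⌝ = ⌜ As ⌝* ⇒* var x
⌜ [] ⌝*     = []
⌜ A ∷ As ⌝* = ⌜ A ⌝ ∷ ⌜ As ⌝*

⌜⌝-wf  : ∀ {n} (A : NF n) → WF ⌜ A ⌝
⌜⌝*-wf : ∀ {n} (As : List (NF n)) → All WF ⌜ As ⌝*
⌜⌝-wf (all A)  = all (⌜⌝-wf A)
⌜⌝-wf (As ⇛ x) = ⇒*-wf (⌜⌝*-wf As) (var x)
⌜⌝*-wf []       = []
⌜⌝*-wf (A ∷ As) = ⌜⌝-wf A ∷ ⌜⌝*-wf As

⌜renNF⌝  : ∀ {m n} (ρ : Fin m → Fin n) A → ⌜ renNF ρ A ⌝ ≡ ren ρ ⌜ A ⌝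
⌜renNFs⌝ : ∀ {m n} (ρ : Fin m → Fin n) As x →
           ⌜ renNFs ρ As ⌝* ⇒* var (ρ x) ≡ ren ρ (⌜ As ⌝* ⇒* var x)
⌜renNF⌝ ρ (all A)  = cong all (⌜renNF⌝ (ext ρ) A)
⌜renNF⌝ ρ (As ⇛ x) = ⌜renNFs⌝ ρ As x
⌜renNFs⌝ ρ []       x = refl
⌜renNFs⌝ ρ (A ∷ As) x = cong₂ _⇒_ (⌜renNF⌝ ρ A) (⌜renNFs⌝ ρ As x)

ext-cong : ∀ {m n} {ρ ρ′ : Fin m → Fin n} → (∀ x → ρ x ≡ ρ′ x) → ∀ x → ext ρ x ≡ ext ρ′ x
ext-cong e zero    = refl
ext-cong e (suc x) = cong suc (e x)

renNF-cong  : ∀ {m n} {ρ ρ′ : Fin m → Fin n} → (∀ x → ρ x ≡ ρ′ x) → ∀ A → renNF ρ A ≡ renNF ρ′ A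
renNFs-cong : ∀ {m n} {ρ ρ′ : Fin m → Fin n} → (∀ x → ρ x ≡ ρ′ x) → ∀ As → renNFs ρ As ≡ renNFs ρ′ As
renNF-cong e (all A)  = cong all (renNF-cong (ext-cong e) A)
renNF-cong e (As ⇛ x) = cong₂ _⇛_ (renNFs-cong e As) (e x)
renNFs-cong e []       = refl
renNFs-cong e (A ∷ As) = cong₂ _∷_ (renNF-cong e A) (renNFs-cong e As)

ext-punchIn : ∀ {n} (x : Fin (suc n)) y → ext (punchIn x) y ≡ punchIn (suc x) y
ext-punchIn x zero    = refl
ext-punchIn x (suc y) = refl

-- `punchIn x` reinserts the slot that strengthening removes. At `zero` it is weakening, which is
-- what `all-vac` needs in `quantify-sound`.
strengthen-punchIn  : ∀ {n} (x : Fin (suc n)) A {A′} →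
                      strengthen x A ≡ just A′ → renNF (punchIn x) A′ ≡ A
strengthens-punchIn : ∀ {n} (x : Fin (suc n)) As {As′} →
                      strengthens x As ≡ just As′ → renNFs (punchIn x) As′ ≡ As
strengthen-punchIn x (all A) eq with strengthen (suc x) A in eq′
strengthen-punchIn x (all A) refl | just A′ =
  cong all (≡.trans (renNF-cong (ext-punchIn x) A′) (strengthen-punchIn (suc x) A eq′))
strengthen-punchIn x (As ⇛ y) eq with x Fin.≟ y
... | no x≢y with strengthens x As in eq′
strengthen-punchIn x (As ⇛ y) refl | no x≢y | just As′ =
  cong₂ _⇛_ (strengthens-punchIn x As eq′) (Fin.punchIn-punchOut x≢y)
strengthens-punchIn x [] refl = refl
strengthens-punchIn x (A ∷ As) eq with strengthen x A in eqA
... | just A′ with strengthens x As in eqAs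
strengthens-punchIn x (A ∷ As) refl | just A′ | just As′ =
  cong₂ _∷_ (strengthen-punchIn x A eqA) (strengthens-punchIn x As eqAs)

arrow-sound : ∀ {n} (A B : NF n) → ⌜ A ⌝ ⇒ ⌜ B ⌝ ≡Y ⌜ arrow A B ⌝
arrow-sound A (all B) =
  trans (axiom (⌜⌝-wf A ⇒ all (⌜⌝-wf B)) (all (wfA ⇒ ⌜⌝-wf B)) (⇒-all _ _))
        (all (subst (λ D → D ⇒ ⌜ B ⌝ ≡Y ⌜ arrow (renNF suc A) B ⌝) (⌜renNF⌝ suc A) (arrow-sound (renNF suc A) B)))
  where wfA = subst WF (⌜renNF⌝ suc A) (⌜⌝-wf (renNF suc A))
arrow-sound A (Bs ⇛ x) = refl (⌜⌝-wf A ⇒ ⌜⌝-wf (Bs ⇛ x))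

quantify-sound : ∀ {n} (A : NF (suc n)) → all ⌜ A ⌝ ≡Y ⌜ quantify A ⌝
quantify-sound A with strengthen zero A in eq
... | nothing = refl (all (⌜⌝-wf A))
... | just A′ =
  sym (subst (λ D → ⌜ A′ ⌝ ≡Y all D) wk≡A
        (axiom (⌜⌝-wf A′) (all (subst WF (≡.sym wk≡A) (⌜⌝-wf A))) (all-vac _)))
  where wk≡A = ≡.trans (≡.sym (⌜renNF⌝ suc A′)) (cong ⌜_⌝ (strengthen-punchIn zero A eq))

nf-sound : ∀ {n} {A : Ty n} (Λ : Λ2 A) → A ≡Y ⌜ nf Λ ⌝
nf-sound (var x) = refl (var x)
nf-sound (A ⇒ B) = trans (nf-sound A ⇒ nf-sound B) (arrow-sound (nf A) (nf B))
nf-sound (all A) = trans (all (nf-sound A)) (quantify-sound (nf A))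

-- Trees and nodes

at-++ : ∀ T p q {S} → T at p ≡ just S → T at (p ++ q) ≡ S at q
at-++ T []      q refl = refl
at-++ (node ys Ts) (i ∷ p) q eq with head (drop i Ts)
... | just U = at-++ U p q eq

at-child : ∀ T p i {ys Ts} → T at p ≡ just (node ys Ts) → T at (p ∷ʳ i) ≡ head (drop i Ts)
at-child T p i {Ts = Ts} eq = ≡.trans (at-++ T p (i ∷ []) eq) (lemma (head (drop i Ts)))
  where
  lemma : (m : Maybe Tree) → (m >>= (_at [])) ≡ m
  lemma (just _) = refl
  lemma nothing  = refl

just-inj : ∀ {X : Set} {x y : X} {m} → m ≡ just x → m ≡ just y → x ≡ y
just-inj e e′ = Maybe.just-injective (≡.trans (≡.sym e) e′)

leaf-inj : ∀ {X Y c e} → leaf X c ≡ leaf Y e → X ≡ Y × c ≡ e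
leaf-inj refl = refl , refl

labelled-maximal : ∀ T {q α X Y c e} → Labelled T q X c → q ≼ α → Labelled T α Y e → α ≡ q
labelled-maximal T l ([] , refl) l′ = List.++-identityʳ _
labelled-maximal T {q} l (i ∷ δ , refl) l′ with () ← ≡.trans (≡.sym (at-++ T q (i ∷ δ) l)) l′

_≟ᶜ_ : (c e : Color) → Dec (c ≡ e)
blue ≟ᶜ blue = yes refl
blue ≟ᶜ red  = no λ ()
red  ≟ᶜ blue = no λ ()
red  ≟ᶜ red  = yes refl

labelled? : ∀ T α X c → Dec (Labelled T α X c)
labelled? T α X c with T at α
... | nothing         = no λ ()
... | just (node _ _) = no λ ()
... | just (leaf Y e) with Y ≟ᴺ X | e ≟ᶜ c
...   | yes refl | yes refl = yes refl
...   | no Y≢X   | _        = no λ { refl → Y≢X refl }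
...   | _        | no e≢c   = no λ { refl → e≢c refl }

≼-∷ʳ : ∀ p i → p ≼ p ∷ʳ i
≼-∷ʳ p i = i ∷ [] , refl

≼-trans : ∀ {p q r} → p ≼ q → q ≼ r → p ≼ r
≼-trans {p} (δ , refl) (ε , refl) = δ ++ ε , List.++-assoc p δ ε

∷ʳ⋠ : ∀ p i → ¬ (p ∷ʳ i ≼ p)
∷ʳ⋠ (_ ∷ p) i (δ , eq) = ∷ʳ⋠ p i (δ , List.∷-injectiveʳ eq)

∷ʳ-++-injective : ∀ (p : Node) {i j} δ ε → p ∷ʳ i ++ δ ≡ p ∷ʳ j ++ ε → i ≡ j
∷ʳ-++-injective []      δ ε eq = List.∷-injectiveˡ eq
∷ʳ-++-injective (_ ∷ p) δ ε eq = ∷ʳ-++-injective p δ ε (List.∷-injectiveʳ eq)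

d-++ : ∀ r v → d (r ++ v) r ≡ length v
d-++ []      []      = refl
d-++ []      (_ ∷ _) = refl
d-++ (i ∷ r) v rewrite dec-true (i ℕ.≟ i) refl = d-++ r v

-- A grandchild of `p` is already at distance at least 2 from any `r` above `p`, so nothing strictly
-- below it meets the distance bound. This pins modular nodes to explicit positions.
deep-node : ∀ {r p i j α} → r ≼ p → p ∷ʳ i ∷ʳ j ≼ α → d α r ≤ 2 → α ≡ p ∷ʳ i ∷ʳ j
deep-node (w , refl) ([] , refl) d≤2 = List.++-identityʳ _
deep-node {r} {_} {i} {j} (w , refl) (k ∷ δ , refl) d≤2 =
  contradiction (subst (_≤ 2) eq d≤2) (ℕ.<⇒≱ (ℕ.≤-trans (s≤s (s≤s (s≤s z≤n))) (ℕ.m≤n+m _ (length w))))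
  where
  v = i ∷ j ∷ k ∷ δ
  path : ((r ++ w) ∷ʳ i ∷ʳ j) ++ k ∷ δ ≡ r ++ (w ++ v)
  path = ≡.trans (List.∷ʳ-++ ((r ++ w) ∷ʳ i) j (k ∷ δ))
        (≡.trans (List.∷ʳ-++ (r ++ w) i (j ∷ k ∷ δ)) (List.++-assoc r w v))
  eq : d (((r ++ w) ∷ʳ i ∷ʳ j) ++ k ∷ δ) r ≡ length w + length v
  eq = ≡.trans (cong (λ α → d α r) path) (≡.trans (d-++ r (w ++ v)) (List.length-++ w))

-- Two cases suffice: the expanded form kept for a variable quantified at the parent is exactly what
-- `tree` computes with an empty label.
data ArgView {n} c p (ρ : Vec Name n) ys : NF n → Tree → Set where
  leaf : ∀ {z} → lookup ρ z ∉ ys → ArgView c p ρ ys ([] ⇛ z) (leaf (lookup ρ z) c)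
  node : ∀ {A} → ArgView c p ρ ys A (tree c p ρ [] A)

argView : ∀ {n} c p (ρ : Vec Name n) ys A → ArgView c p ρ ys A (argTree c p ρ ys A)
argView c p ρ ys (all A) = node
argView c p ρ ys ([] ⇛ z) with lookup ρ z ∈? ys
... | yes _   = node
... | no z∉ys = leaf z∉ys
argView c p ρ ys ((_ ∷ _) ⇛ z) = node

-- A name carries the node at which it was added, and every new node starts with an empty label; so
-- the binding node of a name can be read off the name.
tree-loc : ∀ {n} c p (ρ : Vec Name n) {ys} A q {zs Ts X} → All (λ Y → proj₁ Y ≡ p) ys →
           tree c p ρ ys A at q ≡ just (node zs Ts) → X ∈ zs → proj₁ X ≡ p ++ q
argTrees-loc : ∀ {n} c p (ρ : Vec Name n) ys i As k q {zs Ts X} →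
               (head (drop k (argTrees c p ρ ys i As)) >>= (_at q)) ≡ just (node zs Ts) →
               X ∈ zs → proj₁ X ≡ p ++ (k + i) ∷ q
tree-loc c p ρ (all A) q at-p eq X∈zs = tree-loc c p _ A q (All.∷ʳ⁺ at-p refl) eq X∈zs
tree-loc c p ρ (As ⇛ x) [] at-p refl X∈zs =
  ≡.trans (All.lookup at-p X∈zs) (≡.sym (List.++-identityʳ p))
tree-loc c p ρ (As ⇛ x) (zero ∷ []) at-p () X∈zs
tree-loc c p ρ (As ⇛ x) (zero ∷ _ ∷ q) at-p () X∈zs
tree-loc c p ρ {ys} (As ⇛ x) (suc k ∷ q) {X = X} at-p eq X∈zs =
  subst (λ i → proj₁ X ≡ p ++ i ∷ q) (ℕ.+-comm k 1) (argTrees-loc c p ρ ys 1 As k q eq X∈zs)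
argTrees-loc c p ρ ys i [] zero    q () X∈zs
argTrees-loc c p ρ ys i [] (suc k) q () X∈zs
argTrees-loc c p ρ ys i (A ∷ As) zero q eq X∈zs
  with argTree (other c) (p ∷ʳ i) ρ ys A | argView (other c) (p ∷ʳ i) ρ ys A
argTrees-loc c p ρ ys i (_ ∷ As) zero []      () X∈zs | _ | leaf _
argTrees-loc c p ρ ys i (_ ∷ As) zero (_ ∷ q) () X∈zs | _ | leaf _
... | _ | node = ≡.trans (tree-loc (other c) (p ∷ʳ i) ρ A q [] eq X∈zs) (List.∷ʳ-++ p i q)
argTrees-loc c p ρ ys i (A ∷ As) (suc k) q {X = X} eq X∈zs =
  subst (λ j → proj₁ X ≡ p ++ j ∷ q) (ℕ.+-suc k i) (argTrees-loc c p ρ ys (suc i) As k q eq X∈zs)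

tree-node : ∀ {n} c p (ρ : Vec Name n) ys A →
            ∃₂ λ zs Ts → tree c p ρ ys A ≡ node zs Ts × (∀ {Y} → Y ∈ ys → Y ∈ zs)
tree-node c p ρ ys (all A) with tree-node c p _ (ys ∷ʳ (p , length ys)) A
... | zs , Ts , eq , ⊆ = zs , Ts , eq , ⊆ ∘ Any.++⁺ˡ
tree-node c p ρ ys (As ⇛ x) = ys , _ , refl , id

-- Signs and colors

infixr 7 _∙_

-- The color of the leaf behind an occurrence of the given sign, in the type of a subtree of the
-- given color.
_∙_ : Sign → Color → Color
Sign.+ ∙ c = c
Sign.- ∙ c = other c

other-involutive : ∀ c → other (other c) ≡ c
other-involutive blue = refl
other-involutive red  = refl

other-≢ : ∀ {c} → c ≢ other c
other-≢ {blue} ()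
other-≢ {red}  ()

same-or-other : ∀ c e → c ≡ e ⊎ c ≡ other e
same-or-other blue blue = inj₁ refl
same-or-other blue red  = inj₂ refl
same-or-other red  blue = inj₂ refl
same-or-other red  red  = inj₁ refl

*-∙ : ∀ s₁ s₂ c → (s₁ Sign.* s₂) ∙ c ≡ s₂ ∙ (s₁ ∙ c)
*-∙ Sign.+ s₂     c = refl
*-∙ Sign.- Sign.+ c = refl
*-∙ Sign.- Sign.- c = ≡.sym (other-involutive c)

-- Entering an argument flips both the sign and the color of the subtree, and the two flips cancel.
opposite-∙ : ∀ s c → opposite s ∙ other c ≡ s ∙ c
opposite-∙ Sign.+ c = other-involutive c
opposite-∙ Sign.- c = refl

-- Lists tagged with child positions

module _ {F G : ℕ → Set} {P : ∃ F → Set} (f : ∀ a → P a → G (proj₁ a)) where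

  transform : ∀ as → All P as → List (∃ G)
  transform []       []       = []
  transform (a ∷ as) (p ∷ ps) = (proj₁ a , f a p) ∷ transform as ps

  transform-All : ∀ {Q : ℕ → Set} {as} ps → All (Q ∘ proj₁) as → All (Q ∘ proj₁) (transform as ps)
  transform-All []       []       = []
  transform-All (p ∷ ps) (q ∷ qs) = q ∷ transform-All ps qs

  transform-AllPairs : ∀ {R : ℕ → ℕ → Set} {as} ps → AllPairs (λ a b → R (proj₁ a) (proj₁ b)) as →
                       AllPairs (λ a b → R (proj₁ a) (proj₁ b)) (transform as ps)
  transform-AllPairs []       []       = []
  transform-AllPairs (p ∷ ps) (r ∷ rs) = transform-All ps r ∷ transform-AllPairs ps rs

  map-transform : ∀ {Z : Set} {g : ∃ G → Z} {h : ∃ F → Z} → (∀ a p → g (proj₁ a , f a p) ≡ h a) →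
                  ∀ {as} ps → map g (transform as ps) ≡ map h as
  map-transform e []       = refl
  map-transform e (p ∷ ps) = cong₂ _∷_ (e _ p) (map-transform e ps)

filter-split : ∀ {X : Set} {P : X → Set} (P? : Decidable P) xs →
               xs ↭ filter P? xs ++ filter (¬? ∘ P?) xs
filter-split P? [] = Perm.refl
filter-split P? (x ∷ xs) with P? x
... | yes _ = Perm.prep x (filter-split P? xs)
... | no  _ = Perm.trans (Perm.prep x (filter-split P? xs)) (Perm.↭-sym (Perm.shift x _ _))

-- Distinctness of the tags ensures that the remaining entries sit at other positions than the
-- extracted one.
extract : ∀ {F : ℕ → Set} {P : ∃ F → Set} {as} → AllPairs (λ a b → proj₁ a ≢ proj₁ b) as → Any P as →
          ∃₂ λ a bs → as ↭ a ∷ bs × P a × All (λ b → proj₁ b ≢ proj₁ a) bs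
extract (a≢ ∷ _)  (here p) = _ , _ , Perm.refl , p , All.map (_∘ ≡.sym) a≢
extract {as = a ∷ as} (a≢ ∷ ds) (there q) with extract ds q
... | b , bs , perm , p , ≢b with Perm.All-resp-↭ perm a≢
... | a≢b ∷ _ = b , a ∷ bs , Perm.trans (Perm.prep a perm) (Perm.swap a b Perm.refl) , p , a≢b ∷ ≢b

altPath-++ : ∀ {T m n α β γ} → AltPath T m α β → AltPath T n β γ → AltPath T (m + n) α γ
altPath-++ []           q = q
altPath-++ (step d u p) q = step d u (altPath-++ p q)

-- Types attached to the nodes of a coherent acyclic tree

module Elimination
  (T : Tree) (φ : Name → Color)
  (eliminable : ∀ X → Bound T X → Eliminable T X (φ X))
  (coherent : ∀ X Y → Bound T X → Bound T Y → X ≢ Y → CoherentVars T X (φ X) Y (φ Y))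
  (acyclic : ¬ HasCycle T)
  (loc : ∀ {X r} → BoundAt T X r → proj₁ X ≡ r)
  where

  -- The origin, in the tree, of an occurrence of X in the type computed for
  -- the subtree at q: a node of that subtree, either labelled X itself or
  -- replaced, through the substitutions recorded by the path, by a type
  -- containing X.  Modular nodes are never copied by a substitution.
  data Origin (q : Node) (X : Name) (c : Color) : Set where
    direct : ∀ {α} → q ≼ α → Labelled T α X c → Origin q X c
    via    : ∀ {n α β} → q ≼ α → AltPath T (suc n) α β → Labelled T β X c → c ≡ φ X → Origin q X c

  widen : ∀ {q q′ X c} → q ≼ q′ → Origin q′ X c → Origin q X c
  widen q≼q′ (direct q′≼α l)  = direct (≼-trans q≼q′ q′≼α) l
  widen q≼q′ (via q′≼α p l e) = via (≼-trans q≼q′ q′≼α) p l e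

  -- The field `label` records that a leaf whose variable is still in scope is untouched by earlier
  -- substitutions; this is how a clause is recognised from its leaf.
  record Component {n} (ρ : Vec Name n) (c : Color) (q : Node) : Set where
    constructor component
    field
      ty     : Ty n
      mono   : Mono ty
      origin : ∀ {s x} → Occ s x ty → Origin q (lookup ρ x) (s ∙ c)
      label  : ∀ {x e} → Labelled T q (lookup ρ x) e → ty ≡ var x × e ≡ c

  open Component

  -- Positions are stored because clauses disappear as quantifiers are removed, while the remaining
  -- arguments must still point at nodes of `T`. The label in `hd-leaf` is existential, since its
  -- variable may already be eliminated.
  record Spine {n} (ρ : Vec Name n) (c : Color) (q : Node) (F : ℕ → Set) : Set where
    field
      hd       : Component ρ c (q ∷ʳ 0)
      hd-leaf  : ∃₂ λ Y e → Labelled T (q ∷ʳ 0) Y e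
      args     : List (∃ F)
      distinct : AllPairs (λ a b → proj₁ a ≢ proj₁ b) args
      nonzero  : All (λ a → 0 ≢ proj₁ a) args

  open Spine

  spineTy : ∀ {n} {ρ : Vec Name n} {c q F} → (∃ F → Ty n) → Spine ρ c q F → Ty n
  spineTy g S = map g (args S) ⇒* ty (hd S)

  Body : ∀ {n} → Vec Name n → Color → Node → Set
  Body ρ c q = Spine ρ c q (λ j → Component ρ (other c) (q ∷ʳ j))

  compTy : ∀ {n} {ρ : Vec Name n} {c q} → ∃ (λ j → Component ρ c (q ∷ʳ j)) → Ty n
  compTy = ty ∘ proj₂

  bodyTy : ∀ {n} {ρ : Vec Name n} {c q} → Body ρ c q → Ty n
  bodyTy = spineTy compTy

  body-mono : ∀ {n} {ρ : Vec Name n} {c q} (b : Body ρ c q) → Mono (bodyTy b)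
  body-mono b = ⇒*-mono (map-All (mono ∘ proj₂) (args b)) (mono (hd b))

  -- c is the color of p, hence other c that of the argument.
  data Arg {n} (ρ : Vec Name n) (c : Color) (p : Node) (i : ℕ) : Set where
    leaf : ∀ z → Labelled T (p ∷ʳ i) (lookup ρ z) (other c) → proj₁ (lookup ρ z) ≢ p → Arg ρ c p i
    node : (∀ {Y e} → ¬ Labelled T (p ∷ʳ i) Y e) → Body ρ (other c) (p ∷ʳ i) → Arg ρ c p i

  argTy : ∀ {n} {ρ : Vec Name n} {c p} → ∃ (Arg ρ c p) → Ty n
  argTy (_ , leaf z _ _) = var z
  argTy (_ , node _ b)   = bodyTy b

  arg-mono : ∀ {n} {ρ : Vec Name n} {c p} (a : ∃ (Arg ρ c p)) → Mono (argTy a)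
  arg-mono (_ , leaf z _ _) = var z
  arg-mono (_ , node _ b)   = body-mono b

  -- Two layers below `p` stay visible because a modular node of a variable quantified at `p` is a
  -- grandchild of `p`: the head is excluded, and the expanded form moves any other such leaf one
  -- level down.
  State : ∀ {n} → Vec Name n → Color → Node → Set
  State ρ c p = Spine ρ c p (Arg ρ c p)

  stateTy : ∀ {n} {ρ : Vec Name n} {c p} → State ρ c p → Ty n
  stateTy = spineTy argTy

  state-mono : ∀ {n} {ρ : Vec Name n} {c p} (S : State ρ c p) → Mono (stateTy S)
  state-mono S = ⇒*-mono (map-All arg-mono (args S)) (mono (hd S))

  record Scope {n} (ρ : Vec Name n) (p : Node) : Set where
    field
      injective : ∀ {x y} → lookup ρ x ≡ lookup ρ y → x ≡ y
      outside   : ∀ x → proj₁ (lookup ρ x) ≼ p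
      bound     : ∀ x → Bound T (lookup ρ x)

  open Scope

  modular-deep : ∀ {X c p i j α} → proj₁ X ≼ p → p ∷ʳ i ∷ʳ j ≼ α → Modular T X c α → α ≡ p ∷ʳ i ∷ʳ j
  modular-deep X≼p q≼α m =
    deep-node (subst (_≼ _) (loc (Modular.boundAt m)) X≼p) q≼α (Modular.d≤2 m)

  -- Eliminating one variable `X` quantified at `p`

  module Step {n} (p : Node) (c : Color) (X : Name) (ρ : Vec Name n)
              (scope : Scope (X Vec.∷ ρ) p) (X∈p : proj₁ X ≡ p) where

    X̄ : Color
    X̄ = other (φ X)

    modular : ∀ {α} → Labelled T α X X̄ → Modular T X X̄ α
    modular = eliminable X (bound scope zero) _

    siblings : ∀ {i j k} → j ≢ k → Parallel (p ∷ʳ i ∷ʳ j) (p ∷ʳ i ∷ʳ k)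
    siblings {i} {j} {k} j≢k =
      (j≢k ∘ List.∷ʳ-injectiveʳ (p ∷ʳ i) (p ∷ʳ i)) , p ∷ʳ i , (j , refl) , (k , refl)

    Reach : Node → Fin n → Color → Set
    Reach β y e = ∃₂ λ m δ → AltPath T (suc m) β δ × Labelled T δ (lookup ρ y) e × e ≡ φ (lookup ρ y)

    -- What substituting `D` for `X` requires: from the leaf of color `φ X` where `D` is put, an
    -- alternating path leads to each variable of `D`.
    Follow : Ty (suc n) → Color → Set
    Follow D e = ∀ {s y} → Occ s (suc y) D → ∀ {β} → Labelled T β X (φ X) → Reach β y (s ∙ e)

    module _ {i j k} (j≢k : j ≢ k) (m : Labelled T (p ∷ʳ i ∷ʳ k) X X̄) where

      -- The leaf at `k` is the one that makes argument `i` a clause. A down-move reaches it from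
      -- any `X` of color `φ X`, and an up-move over its parent then reaches the bound variables
      -- below the sibling `j`.
      jump : ∀ {n α β δ Y e} → Bound T Y → p ∷ʳ i ∷ʳ j ≼ α → Labelled T α Y e →
             Labelled T β X (φ X) → AltPath T n α δ → AltPath T (suc n) β δ
      jump {α = α} {Y = Y} {e} bd q≼α@(ε , refl) l l′ path =
        step (X , φ X , bound scope zero , l′ , m , modular m)
             ( (λ eq → j≢k (≡.sym (∷ʳ-++-injective (p ∷ʳ i) [] ε (≡.trans (List.++-identityʳ _) eq))))
             , (X , X̄ , modular m) , (Y , e , bd , l)
             , (p ∷ʳ i , (k , refl) , ≼-trans (≼-∷ʳ (p ∷ʳ i) j) q≼α))
             path

      jump-via : ∀ {n α β δ} → p ∷ʳ i ∷ʳ j ≼ α → Labelled T β X (φ X) →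
                 AltPath T (suc n) α δ → AltPath T (suc (suc n)) β δ
      jump-via q≼α l′ path@(step (_ , _ , bd , l , _) _ _) = jump bd q≼α l l′ path

      module _ {e} (K : Component (X Vec.∷ ρ) e (p ∷ʳ i ∷ʳ j)) where

        -- An occurrence of color `φ X` ends at a leaf from which `jump` leads back to its start,
        -- closing a cycle. One of the other color would be a modular leaf at the sibling itself,
        -- against `unique`.
        sibling-noOcc : NoOcc zero (ty K)
        sibling-noOcc s o with s ∙ e | origin K o | same-or-other (s ∙ e) (φ X)
        ... | _ | direct q≼α l   | inj₁ refl =
          acyclic (_ , _ , s≤s z≤n , jump (bound scope zero) q≼α l l [])
        ... | _ | via q≼α path l _ | inj₁ refl = acyclic (_ , _ , s≤s z≤n , jump-via q≼α l path)
        ... | _ | direct q≼α l   | inj₂ refl =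
          Modular.unique (modular m) _ (siblings (j≢k ∘ ≡.sym))
            (subst (λ α → Labelled T α X X̄)
              (modular-deep (outside scope zero) q≼α (modular l)) l)
        ... | _ | via _ _ _ eq   | inj₂ refl = other-≢ (≡.sym eq)

        -- Each occurrence is reached by a jump, continued by its own path if it has one. The
        -- exception would be a leaf of the color opposite to the one chosen by `φ`: being modular
        -- and parallel to the clause leaf, it is forbidden by coherence.
        sibling-follow : Follow (ty K) e
        sibling-follow {s} {y} o l′ with s ∙ e | origin K o | same-or-other (s ∙ e) (φ (lookup ρ y))
        ... | _ | via q≼α path l eq | _         = _ , _ , jump-via q≼α l′ path , l , eq
        ... | _ | direct q≼α l   | inj₁ refl = _ , _ , jump (bound scope (suc y)) q≼α l l′ [] , l , refl
        ... | _ | direct q≼α l   | inj₂ refl =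
          ⊥-elim (coherent X (lookup ρ y) (bound scope zero) (bound scope (suc y))
            (λ eq → case injective scope {zero} {suc y} eq of λ ())
            (_ , _ , siblings (j≢k ∘ ≡.sym) , modular m ,
              subst (Modular T _ _) (modular-deep (outside scope (suc y)) q≼α m′) m′))
          where m′ = eliminable (lookup ρ y) (bound scope (suc y)) _ l

    -- The first alternative serves (Y+), the second (Y-). A leaf argument never counts, since a
    -- variable quantified at `p` is drawn in expanded form.
    IsClause : ∃ (Arg (X Vec.∷ ρ) c p) → Set
    IsClause (i , leaf _ _ _) = ⊥
    IsClause (i , node _ b)   =
      Labelled T (p ∷ʳ i ∷ʳ 0) X X̄ ⊎ Any (λ a → Labelled T (p ∷ʳ i ∷ʳ proj₁ a) X X̄) (args b)

    isClause? : Decidable IsClause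
    isClause? (i , leaf _ _ _) = no λ ()
    isClause? (i , node _ b)   =
      labelled? T (p ∷ʳ i ∷ʳ 0) X X̄ ⊎-dec Any.any? (λ a → labelled? T (p ∷ʳ i ∷ʳ proj₁ a) X X̄) (args b)

    Plain : Color → Ty (suc n) → Set
    Plain e A = ∀ {s} → Occ s zero A → s ∙ e ≡ φ X

    -- A recorded path ends in color `φ X`, so the wrong color can only come from a modular leaf,
    -- whose sole possible place in this subtree is its root.
    comp-plain : ∀ {i j e} (K : Component (X Vec.∷ ρ) e (p ∷ʳ i ∷ʳ j)) →
                 ¬ Labelled T (p ∷ʳ i ∷ʳ j) X X̄ → Plain e (ty K)
    comp-plain {e = e} K ¬l {s} o with s ∙ e | origin K o | same-or-other (s ∙ e) (φ X)
    ... | _ | _              | inj₁ eq   = eq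
    ... | _ | via _ _ _ eq   | inj₂ _    = eq
    ... | _ | direct q≼α l   | inj₂ refl =
      contradiction (subst (λ α → Labelled T α X X̄)
                      (modular-deep (outside scope zero) q≼α (modular l)) l) ¬l

    -- The head is a leaf, so an occurrence of the wrong color would be that leaf itself: modular,
    -- and yet the head of its own binder.
    hd-plain : ∀ {F} (S : Spine (X Vec.∷ ρ) c p F) → Plain c (ty (hd S))
    hd-plain S {s} o with s ∙ c | origin (hd S) o | same-or-other (s ∙ c) (φ X)
    ... | _ | _              | inj₁ eq   = eq
    ... | _ | via _ _ _ eq   | inj₂ _    = eq
    ... | _ | direct q≼α l   | inj₂ refl =
      contradiction (≡.trans (labelled-maximal T (proj₂ (proj₂ (hd-leaf S))) q≼α l)
                      (cong headOf (≡.trans (≡.sym X∈p) (loc (Modular.boundAt (modular l))))))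
                    (Modular.not-head (modular l))

    spine-plain : ∀ {e q F} (g : ∃ F → Ty (suc n)) (S : Spine (X Vec.∷ ρ) e q F) →
                  All (Plain (other e) ∘ g) (args S) → Plain e (ty (hd S)) → Plain e (spineTy g S)
    spine-plain {e} g S gs h {s} o with occ-⇒* (map g (args S)) o
    ... | inj₂ o′ = h o′
    ... | inj₁ os with All.lookupAny gs (Any.map⁻ os)
    ...   | plain , o′ = ≡.trans (≡.sym (opposite-∙ s e)) (plain o′)

    args-plain : ∀ {i e} {as : List (∃ λ j → Component (X Vec.∷ ρ) e (p ∷ʳ i ∷ʳ j))} →
                 ¬ Any (λ a → Labelled T (p ∷ʳ i ∷ʳ proj₁ a) X X̄) as → All (Plain e ∘ compTy) as
    args-plain ¬ls = All.map (λ {a} → comp-plain (proj₂ a)) (All.¬Any⇒All¬ _ ¬ls)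

    arg-plain : ∀ a → ¬ IsClause a → Plain (other c) (argTy a)
    arg-plain (_ , leaf zero _ X∉p) _  here = contradiction X∈p X∉p
    arg-plain (_ , node _ b)        ¬c =
      spine-plain compTy b (args-plain (¬c ∘ inj₂)) (comp-plain (hd b) (¬c ∘ inj₁))

    -- Substitution for `X`

    module Substitute {C : Ty n} (C-mono : Mono C)
      (follow : ∀ {s y} → Occ s y C → ∀ {β} → Labelled T β X (φ X) → Reach β y (s ∙ φ X))
      where

      -- By plainness all replaced occurrences have color `φ X`, so `follow` applies and its path is
      -- appended to any path already recorded.
      subst-component : ∀ {e q} (K : Component (X Vec.∷ ρ) e q) → Plain e (ty K) → Component ρ e q
      subst-component {e} {q} K plain = component (ty K [ C ]) ([]-mono (mono K) C-mono) orig lf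
        where
        orig : ∀ {s x} → Occ s x (ty K [ C ]) → Origin q (lookup ρ x) (s ∙ e)
        orig o with occ-[] (mono K) o
        ... | outer o′ = origin K o′
        ... | inner {s₁} {s₂} refl o₁ o₂ rewrite *-∙ s₁ s₂ e | plain o₁ with s₁ ∙ e | plain o₁ | origin K o₁
        ...   | _ | refl | direct q≼α l with follow o₂ l
        ...     | _ , _ , path , l′ , eq = via q≼α path l′ eq
        orig o | inner {s₁} {s₂} refl o₁ o₂ | _ | refl | via q≼α path l _ with follow o₂ l
        ...     | _ , _ , path′ , l′ , eq = via q≼α (altPath-++ path path′) l′ eq

        lf : ∀ {x e′} → Labelled T q (lookup ρ x) e′ → ty K [ C ] ≡ var x × e′ ≡ e
        lf l with label K l
        ... | eq , eq′ = cong (_[ C ]) eq , eq′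

      subst-spine : ∀ {e q F G} {P : ∃ F → Set} (f : ∀ a → P a → G (proj₁ a))
                    (S : Spine (X Vec.∷ ρ) e q F) → All P (args S) → Plain e (ty (hd S)) →
                    Spine ρ e q G
      subst-spine f S ps h = record
        { hd       = subst-component (hd S) h
        ; hd-leaf  = hd-leaf S
        ; args     = transform f (args S) ps
        ; distinct = transform-AllPairs f {R = _≢_} ps (distinct S)
        ; nonzero  = transform-All f {Q = 0 ≢_} ps (nonzero S)
        }

      subst-spineTy : ∀ {e q F G} {P : ∃ F → Set} (f : ∀ a → P a → G (proj₁ a))
                      (g : ∃ G → Ty n) (h : ∃ F → Ty (suc n)) →
                      (∀ a pa → g (proj₁ a , f a pa) ≡ h a [ C ]) →
                      (S : Spine (X Vec.∷ ρ) e q F) (ps : All P (args S)) (pl : Plain e (ty (hd S))) →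
                      spineTy g (subst-spine f S ps pl) ≡ spineTy h S [ C ]
      subst-spineTy f g h eq S ps pl =
        ≡.trans (cong (_⇒* _) (≡.trans (map-transform f eq ps) (List.map-∘ (args S))))
                (≡.sym (⇒*-[] (map h (args S))))

      subst-arg : ∀ a → ¬ IsClause a → Arg ρ c p (proj₁ a)
      subst-arg (_ , leaf zero    _ X∉p) _  = contradiction X∈p X∉p
      subst-arg (_ , leaf (suc z) l z∉p) _  = leaf z l z∉p
      subst-arg (_ , node ¬l b)          ¬c =
        node ¬l (subst-spine (λ a → subst-component (proj₂ a)) b
                  (args-plain (¬c ∘ inj₂)) (comp-plain (hd b) (¬c ∘ inj₁)))

      subst-argTy : ∀ a ¬c → argTy (proj₁ a , subst-arg a ¬c) ≡ argTy a [ C ]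
      subst-argTy (_ , leaf zero    _ X∉p) _  = contradiction X∈p X∉p
      subst-argTy (_ , leaf (suc z) l z∉p) _  = refl
      subst-argTy (_ , node ¬l b)          ¬c =
        subst-spineTy (λ a → subst-component (proj₂ a)) compTy compTy (λ _ _ → refl) b _
          (comp-plain (hd b) (¬c ∘ inj₁))

    -- Arguments as clauses of (Y+) and (Y-)

    record Clause⁺View (a : ∃ (Arg (X Vec.∷ ρ) c p)) : Set where
      field
        prems       : List (Ty (suc n))
        shape       : argTy a ≡ prems ⇒* var zero
        prems-mono  : All Mono prems
        prems-noOcc : All (NoOcc zero) prems
        follow      : Follow (Prod prems) (φ X)

    record Clause⁻View (a : ∃ (Arg (X Vec.∷ ρ) c p)) : Set where
      field
        concl       : Ty (suc n)
        shape       : argTy a ≡Y var zero ⇒ concl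
        concl-mono  : Mono concl
        concl-noOcc : NoOcc zero concl
        follow      : Follow concl (φ X)

    -- Colors alternate with depth: when `φ X` is the color of `p`, the head of an argument has
    -- color `X̄` and its own arguments do not, so the clause leaf is the head.
    clause⁺View : φ X ≡ c → ∀ a → IsClause a → Clause⁺View a
    clause⁺View φX≡c (i , node _ b) (inj₂ ls) with Any.satisfied ls
    ... | a , l = contradiction
      (≡.trans (≡.sym (cong other φX≡c)) (proj₂ (label (proj₂ a) {zero} l))) other-≢
    clause⁺View φX≡c (i , node _ b) (inj₁ l) = record
      { prems       = map compTy (args b)
      ; shape       = cong (map compTy (args b) ⇒*_) (proj₁ (label (hd b) {zero} l))
      ; prems-mono  = map-All (mono ∘ proj₂) (args b)
      ; prems-noOcc = All.map⁺ (All.map (λ {a} 0≢j → sibling-noOcc (0≢j ∘ ≡.sym) l (proj₂ a)) (nonzero b))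
      ; follow      = subst (Follow _) (≡.trans (other-involutive c) (≡.sym φX≡c)) follow
      }
      where
      follow : Follow (Prod (map compTy (args b))) (other (other c))
      follow o with Any.map⁻ (occ-Prod (map compTy (args b)) o)
      ... | w with All.lookupAny (nonzero b) w
      ...   | 0≢j , o′ = sibling-follow (0≢j ∘ ≡.sym) l (proj₂ (Any.lookup w)) o′

    -- Dually, `X̄` is now the color of the arguments of the clause. The clause leaf is one of them
    -- and is permuted to the front, hence a shape only up to `≡Y`.
    clause⁻View : φ X ≡ other c → ∀ a → IsClause a → Clause⁻View a
    clause⁻View φX≡c̄ (i , node _ b) (inj₁ l) = contradiction
      (≡.trans φX≡c̄ (≡.sym (proj₂ (label (hd b) {zero} l)))) other-≢
    clause⁻View φX≡c̄ (i , node _ b) (inj₂ ls) with extract (distinct b) ls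
    ... | a , bs , perm , l , ≢a with Perm.All-resp-↭ perm (nonzero b)
    ...   | 0≢a ∷ _ = record
      { concl       = D
      ; shape       = subst (λ A → bodyTy b ≡Y A ⇒ D) (proj₁ (label (proj₂ a) {zero} l))
                        (⇒*-↭ (map-All (mono⇒wf ∘ mono ∘ proj₂) (args b)) (mono⇒wf (mono (hd b)))
                          (Perm.map⁺ compTy perm))
      ; concl-mono  = ⇒*-mono (map-All (mono ∘ proj₂) bs) (mono (hd b))
      ; concl-noOcc = noOcc
      ; follow      = follow
      }
      where
      D = map compTy bs ⇒* ty (hd b)
      noOcc : NoOcc zero D
      noOcc s o with occ-⇒* (map compTy bs) o
      ... | inj₂ o′ = sibling-noOcc 0≢a l (hd b) s o′
      ... | inj₁ os with All.lookupAny ≢a (Any.map⁻ os)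
      ...   | j≢a , o′ = sibling-noOcc j≢a l (proj₂ (Any.lookup (Any.map⁻ os))) _ o′
      follow : Follow D (φ X)
      follow {s} o {β} l′ with occ-⇒* (map compTy bs) o
      ... | inj₂ o′ = subst (Reach β _ ∘ (s ∙_)) (≡.sym φX≡c̄) (sibling-follow 0≢a l (hd b) o′ l′)
      ... | inj₁ os with All.lookupAny ≢a (Any.map⁻ os)
      ...   | j≢a , o′ =
        subst (Reach β _) (≡.trans (opposite-∙ s (other c)) (cong (s ∙_) (≡.sym φX≡c̄)))
          (sibling-follow j≢a l (proj₂ (Any.lookup (Any.map⁻ os))) o′ l′)

    collect⁺ : ∀ {as} → All Clause⁺View as → ∃[ Ps ]
      map argTy as ≡ map (_⇒* var zero) Ps × All (All Mono) Ps ×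
      All (All (NoOcc zero)) Ps × All (λ Qs → Follow (Prod Qs) (φ X)) Ps
    collect⁺ [] = [] , refl , [] , [] , []
    collect⁺ (v ∷ vs) with collect⁺ vs
    ... | Ps , eq , ms , ns , fs =
      prems ∷ Ps , cong₂ _∷_ shape eq , prems-mono ∷ ms , prems-noOcc ∷ ns , follow ∷ fs
      where open Clause⁺View v

    collect⁻ : ∀ {as} → All Clause⁻View as → ∃[ Ds ]
      (∀ {R} → WF R → map argTy as ⇒* R ≡Y map (var zero ⇒_) Ds ⇒* R) × All Mono Ds ×
      All (NoOcc zero) Ds × All (λ D → Follow D (φ X)) Ds
    collect⁻ [] = [] , refl , [] , [] , []
    collect⁻ (v ∷ vs) with collect⁻ vs
    ... | Ds , eq , ms , ns , fs =
      concl ∷ Ds , (λ r → shape ⇒ eq r) , concl-mono ∷ ms , concl-noOcc ∷ ns , follow ∷ fs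
      where open Clause⁻View v

    -- The clauses are moved to the front. What remains is plain in `X`, and comparing `φ X` with
    -- the color of `p` turns plainness into the sign demanded by the rule. Without clauses, `X`
    -- becomes `𝟘` or `𝟙`.
    eliminate : (S : State (X Vec.∷ ρ) c p) → ∃ λ (S′ : State ρ c p) → all (stateTy S) ≡Y stateTy S′
    eliminate S = case same-or-other (φ X) c of λ where
        (inj₁ φX≡c) → positive φX≡c (collect⁺ (All.map (λ {a} → clause⁺View φX≡c a) clauses-ok))
        (inj₂ φX≡c̄) → negative φX≡c̄ (collect⁻ (All.map (λ {a} → clause⁻View φX≡c̄ a) clauses-ok))
      where
      clauses rest : List (∃ (Arg (X Vec.∷ ρ) c p))
      clauses = filter isClause? (args S)
      rest    = filter (¬? ∘ isClause?) (args S)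

      clauses-ok : All IsClause clauses
      clauses-ok = All.all-filter isClause? (args S)
      rest-ok : All (¬_ ∘ IsClause) rest
      rest-ok = All.all-filter (¬? ∘ isClause?) (args S)

      S₀ : State (X Vec.∷ ρ) c p
      S₀ = record S
        { args     = rest
        ; distinct = AllPairs.filter⁺ (¬? ∘ isClause?) (distinct S)
        ; nonzero  = All.filter⁺ (¬? ∘ isClause?) (nonzero S)
        }

      R : Ty (suc n)
      R = stateTy S₀
      R-mono : Mono R
      R-mono = state-mono S₀
      R-plain : Plain c R
      R-plain = spine-plain argTy S₀ (All.map (λ {a} → arg-plain a) rest-ok) (hd-plain S)

      clauses-first : all (stateTy S) ≡Y all (map argTy clauses ⇒* R)
      clauses-first =
        all (subst (stateTy S ≡Y_) (++-⇒* (map argTy clauses) (map argTy rest))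
          (subst (λ As → stateTy S ≡Y As ⇒* ty (hd S)) (List.map-++ argTy clauses rest)
            (⇒*-↭ (map-All (mono⇒wf ∘ arg-mono) (args S)) (mono⇒wf (mono (hd S)))
              (Perm.map⁺ argTy (filter-split isClause? (args S))))))

      conclude : ∀ {D} → Mono D → NoOcc zero D → Follow D (φ X) →
                 all (map argTy clauses ⇒* R) ≡Y R [ D [ 𝟙 ] ] →
                 ∃ λ (S′ : State ρ c p) → all (stateTy S) ≡Y stateTy S′
      conclude {D} D-mono D∌0 D-follow eq =
        subst-spine subst-arg S₀ rest-ok (hd-plain S) ,
        trans clauses-first
          (subst (all (map argTy clauses ⇒* R) ≡Y_)
            (≡.sym (subst-spineTy subst-arg argTy argTy subst-argTy S₀ rest-ok (hd-plain S))) eq)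
        where
        open Substitute ([]-mono D-mono 𝟙)
          -- Weakening carries an occurrence in `D [ 𝟙 ]` back to `D`, where `D-follow` applies.
          (λ o → D-follow (subst (Occ _ _) (wk-[𝟙] D-mono D∌0) (occ-ren {ρ = suc} o)))

      positive : φ X ≡ c → _ → _
      positive φX≡c (Ps , eq , ms , ns , fs) =
        conclude (Sum-mono (All.map⁺ (All.map Prod-mono ms))) S∌0
          (λ o → let f , o′ = All.lookupAny fs (Any.map⁻ (occ-Sum (map Prod Ps) o)) in f o′)
          (subst (λ As → all (As ⇒* R) ≡Y R [ Sum (map Prod Ps) [ 𝟙 ] ]) (≡.sym eq)
            (Y⁺₀ Ps ms R-mono ns pos S∌0))
        where
        S∌0 : NoOcc zero (Sum (map Prod Ps))
        S∌0 s o with All.lookupAny ns (Any.map⁻ (occ-Sum (map Prod Ps) o))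
        ... | n′ , o′ with All.lookupAny n′ (occ-Prod _ o′)
        ...   | ∌0 , o″ = ∌0 _ o″
        pos : OnlyPos zero R
        pos {Sign.+} o = refl
        pos {Sign.-} o = contradiction (≡.sym (≡.trans (R-plain o) φX≡c)) other-≢

      negative : φ X ≡ other c → _ → _
      negative φX≡c̄ (Ds , eq , ms , ns , fs) =
        conclude (Prod-mono ms) P∌0
          (λ o → let f , o′ = All.lookupAny fs (occ-Prod Ds o) in f o′)
          (trans (all (eq (mono⇒wf R-mono))) (Y⁻₀ Ds ms R-mono ns neg P∌0))
        where
        P∌0 : NoOcc zero (Prod Ds)
        P∌0 s o with All.lookupAny ns (occ-Prod Ds o)
        ... | ∌0 , o′ = ∌0 _ o′
        neg : OnlyNeg zero R
        neg {Sign.+} o = contradiction (≡.trans (R-plain o) φX≡c̄) other-≢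
        neg {Sign.-} o = refl

  -- Closing a node whose quantifiers are eliminated

  body-component : ∀ {n} {ρ : Vec Name n} {c q} → (∀ {Y e} → ¬ Labelled T q Y e) →
                   Body ρ c q → Component ρ c q
  body-component {ρ = ρ} {c} {q} ¬l b =
    component (bodyTy b) (body-mono b) orig (λ l → contradiction l ¬l)
    where
    orig : ∀ {s x} → Occ s x (bodyTy b) → Origin q (lookup ρ x) (s ∙ c)
    orig {s} {x} o with occ-⇒* (map compTy (args b)) o
    ... | inj₂ o′ = widen (≼-∷ʳ q 0) (origin (hd b) o′)
    ... | inj₁ os with Any.satisfied (Any.map⁻ os)
    ...   | (j , K) , o′ =
      subst (Origin q (lookup ρ x)) (opposite-∙ s c) (widen (≼-∷ʳ q j) (origin K o′))

  leaf-component : ∀ {n} {ρ : Vec Name n} {c p q} → Scope ρ p → ∀ z →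
                   Labelled T q (lookup ρ z) c → Component ρ c q
  leaf-component {ρ = ρ} {c} {q = q} scope z l =
    component (var z) (var z) (λ { here → direct ([] , ≡.sym (List.++-identityʳ q)) l }) λ l′ →
      let eq , eq′ = leaf-inj (just-inj l l′) in cong var (injective scope eq) , ≡.sym eq′

  arg-component : ∀ {n} {ρ : Vec Name n} {c p} → Scope ρ p → (a : ∃ (Arg ρ c p)) →
                  Component ρ (other c) (p ∷ʳ proj₁ a)
  arg-component scope (i , leaf z l _)  = leaf-component scope z l
  arg-component scope (i , node ¬l b)   = body-component ¬l b

  arg-component-ty : ∀ {n} {ρ : Vec Name n} {c p} (scope : Scope ρ p) (a : ∃ (Arg ρ c p)) →
                     ty (arg-component scope a) ≡ argTy a
  arg-component-ty scope (_ , leaf _ _ _) = refl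
  arg-component-ty scope (_ , node _ _)   = refl

  -- With no quantifier left at `p`, its grandchildren need not stay visible: each argument is
  -- closed into one component, so that `p` can itself serve as an argument of its parent.
  body : ∀ {n} {ρ : Vec Name n} {c p} → Scope ρ p → State ρ c p → Body ρ c p
  body scope S = record
    { hd       = hd S
    ; hd-leaf  = hd-leaf S
    ; args     = map (λ a → proj₁ a , arg-component scope a) (args S)
    ; distinct = AllPairs.map⁺ (distinct S)
    ; nonzero  = All.map⁺ (nonzero S)
    }

  body-ty : ∀ {n} {ρ : Vec Name n} {c p} (scope : Scope ρ p) (S : State ρ c p) →
            bodyTy (body scope S) ≡ stateTy S
  body-ty scope S = cong (_⇒* ty (hd S))
    (≡.trans (≡.sym (List.map-∘ (args S))) (List.map-cong (arg-component-ty scope) (args S)))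

  -- Evaluation of a normal form

  Local : ∀ {n} → Vec Name n → Node → List Name → Set
  Local ρ p ys = ∀ x → proj₁ (lookup ρ x) ≡ p → lookup ρ x ∈ ys × proj₂ (lookup ρ x) < length ys

  module _ {n} {ρ : Vec Name n} {p} (scope : Scope ρ p) where

    scope-child : ∀ i → Scope ρ (p ∷ʳ i)
    scope-child i = record
      { injective = injective scope
      ; outside   = λ x → ≼-trans (outside scope x) (≼-∷ʳ p i)
      ; bound     = bound scope
      }

    local-child : ∀ i → Local ρ (p ∷ʳ i) []
    local-child i x eq = contradiction (subst (_≼ p) eq (outside scope x)) (∷ʳ⋠ p i)

    module _ {ys} (local : Local ρ p ys) where

      Y : Name
      Y = p , length ys

      -- Indices already used at `p` are below the length of its label, and names from other nodes
      -- differ in their first component.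
      Y-fresh : ∀ x → lookup ρ x ≢ Y
      Y-fresh x eq = ℕ.<-irrefl (cong proj₂ eq) (proj₂ (local x (cong proj₁ eq)))

      scope-binder : Bound T Y → Scope (Y Vec.∷ ρ) p
      scope-binder bd = record
        { injective = λ { {zero}  {zero}  _  → refl
                        ; {zero}  {suc y} eq → contradiction (≡.sym eq) (Y-fresh y)
                        ; {suc x} {zero}  eq → contradiction eq (Y-fresh x)
                        ; {suc x} {suc y} eq → cong suc (injective scope eq) }
        ; outside   = λ { zero → [] , ≡.sym (List.++-identityʳ p) ; (suc x) → outside scope x }
        ; bound     = λ { zero → bd ; (suc x) → bound scope x }
        }

      length-∷ʳ : length (ys ∷ʳ Y) ≡ suc (length ys)
      length-∷ʳ = ≡.trans (List.length-++ ys) (ℕ.+-comm (length ys) 1)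

      local-binder : Local (Y Vec.∷ ρ) p (ys ∷ʳ Y)
      local-binder zero    eq =
        Any.++⁺ʳ ys (here refl) , ℕ.≤-reflexive (≡.sym length-∷ʳ)
      local-binder (suc x) eq with local x eq
      ... | ∈ys , <len =
        Any.++⁺ˡ ∈ys , ℕ.≤-trans <len (ℕ.≤-trans (ℕ.n≤1+n _) (ℕ.≤-reflexive (≡.sym length-∷ʳ)))

  -- The body is evaluated before its quantifier is eliminated, so inner quantifiers and arguments
  -- are settled first. The hypothesis on `T at p` passes to the body unchanged, because a
  -- quantifier only extends the label of `p`.
  eval : ∀ {n} c p (ρ : Vec Name n) ys A → T at p ≡ just (tree c p ρ ys A) →
         Scope ρ p → Local ρ p ys → ∃ λ (S : State ρ c p) → ⌜ A ⌝ ≡Y stateTy S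
  evalArg : ∀ {n} c p (ρ : Vec Name n) ys i A → T at (p ∷ʳ i) ≡ just (argTree (other c) (p ∷ʳ i) ρ ys A) →
            Scope ρ p → Local ρ p ys → ∃ λ (a : Arg ρ c p i) → ⌜ A ⌝ ≡Y argTy (i , a)
  evalArgs : ∀ {n} c p (ρ : Vec Name n) ys i As →
             (∀ k → T at (p ∷ʳ (k + i)) ≡ head (drop k (argTrees c p ρ ys i As))) →
             Scope ρ p → Local ρ p ys → ∃ λ (as : List (∃ (Arg ρ c p))) →
             All (λ a → i ≤ proj₁ a) as × AllPairs (λ a b → proj₁ a ≢ proj₁ b) as ×
             (∀ {B} → WF B → ⌜ As ⌝* ⇒* B ≡Y map argTy as ⇒* B)
  eval c p ρ ys (all A) at-p scope local
    -- The new name survives into the final label of `p`, which makes it bound in `T`.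
    with tree-node c p ((p , length ys) Vec.∷ ρ) (ys ∷ʳ (p , length ys)) A
  ... | zs , Ts , eq , ⊆zs
    with scope-binder scope local (p , zs , Ts , ≡.trans at-p (cong just eq) , ⊆zs (Any.++⁺ʳ ys (here refl)))
  ...   | scope′ with eval c p _ _ A at-p scope′ (local-binder scope local)
  ...     | S , e with Step.eliminate p c (p , length ys) ρ scope′ refl S
  ...       | S′ , e′ = S′ , trans (all e) e′
  eval c p ρ ys (As ⇛ x) at-p scope local
    with at-child T p 0 at-p
       | evalArgs c p ρ ys 1 As
           (λ k → subst (λ i → T at (p ∷ʳ i) ≡ head (drop k (argTrees c p ρ ys 1 As)))
                    (ℕ.+-comm 1 k) (at-child T p (suc k) at-p))
           scope local
  ... | l | as , 1≤ , ds , e = S , e (var x)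
    where
    S : State ρ c p
    S = record
      { hd       = leaf-component scope x l
      ; hd-leaf  = _ , _ , l
      ; args     = as
      ; distinct = ds
      ; nonzero  = All.map ℕ.<⇒≢ 1≤
      }
  evalArg c p ρ ys i A at-i scope local
    with argTree (other c) (p ∷ʳ i) ρ ys A | argView (other c) (p ∷ʳ i) ρ ys A
  ... | _ | leaf {z} z∉ys = leaf z at-i (z∉ys ∘ proj₁ ∘ local z) , refl (var z)
  ... | _ | node with eval (other c) (p ∷ʳ i) ρ [] A at-i (scope-child scope i) (local-child scope i)
                    | tree-node (other c) (p ∷ʳ i) ρ [] A
  ...   | S , e | _ , _ , eq , _ =
    node (λ l → case ≡.trans (≡.sym eq) (just-inj at-i l) of λ ()) (body scope′ S) ,
    subst (⌜ A ⌝ ≡Y_) (≡.sym (body-ty scope′ S)) e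
    where scope′ = scope-child scope i
  evalArgs c p ρ ys i [] at-is scope local = [] , [] , [] , refl
  evalArgs c p ρ ys i (A ∷ As) at-is scope local
    with evalArg c p ρ ys i A (at-is 0) scope local
       | evalArgs c p ρ ys (suc i) As
           (λ k → subst (λ j → T at (p ∷ʳ j) ≡ head (drop k (argTrees c p ρ ys (suc i) As)))
                    (≡.sym (ℕ.+-suc k i)) (at-is (suc k)))
           scope local
  ... | a , e | as , i< , ds , es =
    (i , a) ∷ as , ℕ.≤-refl ∷ All.map ℕ.<⇒≤ i< , All.map ℕ.<⇒≢ i< ∷ ds , λ b → e ⇒ es b

corollary5p2 : (A : Ty 0) (Λ : Λ2 A) → κ Λ ≈ c0 → ∃[ k ] (A ≡Y ones k)
corollary5p2 A Λ (zero (φ , eliminable , coherent) acyclic) =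
  let S , e = eval blue [] Vec.[] [] (nf Λ) refl closed (λ ()) in
  -- The root is evaluated in the empty scope, so the type of its state is closed as well as
  -- binder-free.
  map₂ (trans (trans (nf-sound Λ) e)) (mono-ones (state-mono S))
  where
  open Elimination (t Λ) φ eliminable coherent acyclic
    (λ (_ , _ , eq , X∈zs) → tree-loc blue [] Vec.[] (nf Λ) _ [] eq X∈zs)
  closed : Scope Vec.[] []
  closed = record { injective = λ { {()} } ; outside = λ () ; bound = λ () }
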